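{- Let $m\ge 3$ be odd, let $\tilde M=(\tilde m_{i,j})_{i,j\in[0,m-1]}$ be a magic square of side $m$ with magic constant $\tilde\mu$, and let $Q$ be the $2m\times 2m$ $D_{2m^2}$-semi-magic square built from $\tilde M$ with blocks $Q^{11},Q^{12},Q^{21},Q^{22}$ as described in the context. Let $i,j,c\in[0,m-1]$. For $u,v\in\{1,2\}$ with $u+v$ odd, $$\rho^{uv}_{i,c}=\begin{cases} r^{2\tilde\mu-(m-2)(m-1)/2+1}, & c \text{ odd or } c=0,\\ r^{ -2\tilde\mu+(m-2)(m-1)/2-1}, & c\text{ even and } c\neq 0,\end{cases}$$ $$\sigma^{uv}_{j,c}=\begin{cases} r^{2\tilde\mu-(m-2)(m-1)/2+1}, & c \text{ odd or } c=0,\\ r^{ -2\tilde\mu+(m-2)(m-1)/2-1}, & c\text{ even and } c\neq 0.\end{cases}$$ Consequently, the magic constant of $Q$ depends on the chosen ordering: the row products are $$\rho_i=\rho^{u1}_{i,0}\,\rho^{u2}_{i,c}=\begin{cases} r^{4\tilde\mu-(m-2)(m-1)/2+1}, & c \text{ odd or } c=0,\\ r^{(m-2)(m-1)/2-1}, & c\text{ even and } c\neq 0,\end{cases}$$ and similarly the column products are $$\sigma_j=\sigma^{1v}_{j,0}\,\sigma^{2v}_{j,c}=\begin{cases} r^{4\tilde\mu-(m-2)(m-1)/2+1}, & c \text{ odd or } c=0,\\ r^{(m-2)(m-1)/2-1}, & c\text{ even and } c\neq 0.\end{cases}$$ Thus two distinct magic constants may arise from the same semi-magic square $Q$, depending on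 the order in which the products are taken.
   Context: $[a,b]$ denotes the set of integers from $a$ to $b$ (empty if $a>b$). The dihedral group $D_k$ ($k\ge3$) has order $2k$ and elements $r^i$ (rotations) and $r^is$ (reflections), $0\le i\le k-1$, with $r^k=e$, $(r^is)^2=e$, $r^is=sr^{ -i}$. A magic square of side $m$ is an $m\times m$ array containing each of $1,2,\dots,m^2$ exactly once such that every row, every column and both main diagonals have the same sum $\tilde\mu=m(m^2+1)/2$ (the magic constant). For a group $\Gamma$ of order $n^2$, a $\Gamma$-semi-magic square of side $n$ with magic constant $\mu\in\Gamma$ is an $n\times n$ array containing each element of $\Gamma$ exactly once such that for every row, and for every column, there is an ordering of its entries in which their product equals $\mu$. Construction of $Q$ for $m$ odd. Row and column indices $i,j$ range over $[0,m-1]$; subscripts of $e,o,t$ and $q$ are read modulo $m$, and exponents of $r$ are read modulo $2m^2$. Put $e_{i,j}=2\tilde m_{i,j}$, $o_{i,j}=2\tilde m_{i,j}+1$, $t_{i,j}=-2\tilde m_{i,j}+m-2$ (all modulo $2m^2$). Define $m\times m$ arrays $Q^{uv}=(q^{uv}_{i,j})$, $u,v\in\{1,2\}$, by - $q^{11}_{i,j}=r^{e_{i,j}}$ for all $i,j$; - $q^{22}_{i,j}=r^{e_{i,j}}s$ if $j=i$; $\;r^{t_{i,j}}s$ if $j\equiv i+1\pmod m$; $\;r^{o_{i,j}}$ otherwise; - $q^{12}_{i,j}=r^{o_{i,j}}$ if $j=i$; $\;r^{e_{i,j}}s$ if $i+j$ is odd and $j\in[i+1,m-1]$, or $i+j$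 is even and $j\in[0,i-1]$; $\;r^{t_{i,j}}s$ if $i+j$ is even and $j\in[i+2,m-1]$, or $i+j$ is odd and $j\in[0,i-1]$; - $q^{21}_{i,j}=r^{o_{i,j+1}}$ if $j=i$; $\;r^{e_{i,j+1}}s$ if $i+j$ is odd and $j\in[i+1,m-1]$, or $i+j$ is even and $j\in[0,i-1]$; $\;r^{t_{i,j+1}}s$ if $i+j$ is even and $j\in[i+2,m-1]$, or $i+j$ is odd and $j\in[0,i-1]$. The square $Q$ is the $2m\times 2m$ block array with $Q^{11}$ top left, $Q^{12}$ top right, $Q^{21}$ bottom left, $Q^{22}$ bottom right. A row of $Q$ is given by $u\in\{1,2\}$ and $i\in[0,m-1]$ (row $i$ of $Q^{u1}$ followed by row $i$ of $Q^{u2}$), and a column by $v\in\{1,2\}$ and $j\in[0,m-1]$ (column $j$ of $Q^{1v}$ above column $j$ of $Q^{2v}$); $\rho_i$ and $\sigma_j$ denote the corresponding row and column products. For $c\in[0,m-1]$, define the products of all $m$ entries of a row or column of a block, taken in cyclic order (subscripts modulo $m$): $$\rho^{uv}_{i,c}=q^{uv}_{i,i+c}\,q^{uv}_{i,i+c+1}\cdots q^{uv}_{i,i+c-1},\qquad \sigma^{uv}_{j,c}=q^{uv}_{j-c,j}\,q^{uv}_{j-c-1,j}\cdots q^{uv}_{j-c+1,j}.$$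
   Formalization: For u=2 (v=2) the printed product formula fails (m=3, c=2 gives r^6, not r^0), so the offset c is put on the block with u+v odd; the printed form is kept there only for odd c≠1 (and c=0). The two constants are claimed distinct only for m≠5, since they coincide at m=5. -}

module Defs where

open import Algebra.Bundles using (Group)
import Algebra.Properties.CommutativeMonoid.Sum as Sum
open import Data.Fin as Fin using (Fin; toℕ; opposite)
open import Data.Fin.Patterns using (0F; 1F)
open import Data.Fin.Properties using (nonZeroIndex)
open import Data.Integer as ℤ using (ℤ; +_; -_)
open import Data.Integer.Divisibility.Signed as ℤ using (divides)
open import Data.Integer.Tactic.RingSolver using (solve-∀)
open import Data.List using (List; foldr)
open import Data.List.Relation.Binary.Permutation.Propositional using (_↭_)
open import Data.Nat using (ℕ; _+_; _*_; _∸_; _/_; _<_; _≤_)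
open import Data.Nat.Divisibility using (_∣_; _∣?_)
open import Data.Nat.DivMod using (_mod_)
open import Data.Nat.Properties using (+-0-commutativeMonoid; _<?_)
open import Data.Product using (_×_; _,_; ∃-syntax; ∃!; uncurry)
open import Data.Sum using (_⊎_)
open import Data.Vec.Functional using (Vector; toList; zipWith; _++_)
open import Level using (Level; 0ℓ; _⊔_)
open import Relation.Binary.PropositionalEquality using (_≡_; _≢_; refl; subst)
open import Relation.Nullary using (¬_; Dec; ¬?; does)
open import Relation.Nullary.Decidable using (_×-dec_; _⊎-dec_)
open import Data.Bool using (if_then_else_)

private
  variable
    a ℓ : Level
    A : Set a
    n : ℕ

Even Odd : ℕ → Set
Even n = 2 ∣ n
Odd n = ¬ Even n

Array : Set a → ℕ → Set a
Array A n = Vector (Vector A n) n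

open Sum +-0-commutativeMonoid using (sum)

-- The division is exact: m (m² + 1) is always even.
magicConstant : ℕ → ℕ
magicConstant m = (m * (m * m + 1)) / 2

record IsMagicSquare {m : ℕ} (M : Array ℕ m) : Set where
  field
    entry-range  : ∀ i j → 1 ≤ M i j × M i j ≤ m * m
    exactly-once : ∀ k → 1 ≤ k → k ≤ m * m →
                   ∃! _≡_ (λ (cell : Fin m × Fin m) → uncurry M cell ≡ k)
    row          : ∀ i → sum (λ j → M i j) ≡ magicConstant m
    column       : ∀ j → sum (λ i → M i j) ≡ magicConstant m
    diagonal     : sum (λ i → M i i) ≡ magicConstant m
    antidiagonal : sum (λ i → M i (opposite i)) ≡ magicConstant m

module _ (Γ : Group a ℓ) where
  open Group Γ

  product : List Carrier → Carrier
  product = foldr _∙_ ε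

  -- "exactly-once" makes the n² cells a system of representatives for the
  -- elements of Γ, so that Γ necessarily has order n².
  record IsSemiMagicSquare {n : ℕ} (Q : Array Carrier n) (μ : Carrier) : Set (a ⊔ ℓ) where
    field
      exactly-once : ∀ g → ∃! _≡_ (λ (cell : Fin n × Fin n) → uncurry Q cell ≈ g)
      row          : ∀ i → ∃[ xs ] xs ↭ toList (λ j → Q i j) × product xs ≈ μ
      column       : ∀ j → ∃[ xs ] xs ↭ toList (λ i → Q i j) × product xs ≈ μ

-- Elements of the dihedral group of order 2k.  Exponents are arbitrary integers;
-- they are read modulo k by the setoid equality _≈ᴰ_ below.
infix 8 r^_

data Dih : Set where
  r^_   : ℤ → Dih
  r^_·s : ℤ → Dih

module _ (k : ℕ) where

  infix 4 _≡ₖ_ _≈ᴰ_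

  -- Congruence modulo k; a record so that x and y can be inferred.
  record _≡ₖ_ (x y : ℤ) : Set where
    constructor congruent
    field k∣x-y : + k ℤ.∣ x ℤ.- y

  data _≈ᴰ_ : Dih → Dih → Set where
    rotation   : ∀ {x y} → x ≡ₖ y → r^ x ≈ᴰ r^ y
    reflection : ∀ {x y} → x ≡ₖ y → r^ x ·s ≈ᴰ r^ y ·s

  private
    by : ∀ {x y} → x ≡ y → + k ℤ.∣ x → + k ℤ.∣ y
    by = subst (+ k ℤ.∣_)

    ≡ₖ-reflexive : ∀ {x y} → x ≡ y → x ≡ₖ y
    ≡ₖ-reflexive {x} refl = congruent (divides (+ 0) (lemma x))
      where
      lemma : ∀ x → x ℤ.- x ≡ + 0
      lemma = solve-∀

    ≡ₖ-sym : ∀ {x y} → x ≡ₖ y → y ≡ₖ x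
    ≡ₖ-sym {x} {y} (congruent p) = congruent (by (lemma x y) (ℤ.∣m⇒∣-m p))
      where
      lemma : ∀ x y → - (x ℤ.- y) ≡ y ℤ.- x
      lemma = solve-∀

    ≡ₖ-trans : ∀ {x y z} → x ≡ₖ y → y ≡ₖ z → x ≡ₖ z
    ≡ₖ-trans {x} {y} {z} (congruent p) (congruent q) = congruent (by (lemma x y z) (ℤ.∣m∣n⇒∣m+n p q))
      where
      lemma : ∀ x y z → (x ℤ.- y) ℤ.+ (y ℤ.- z) ≡ x ℤ.- z
      lemma = solve-∀

    ≡ₖ-+ : ∀ {x y u v} → x ≡ₖ y → u ≡ₖ v → x ℤ.+ u ≡ₖ y ℤ.+ v
    ≡ₖ-+ {x} {y} {u} {v} (congruent p) (congruent q) =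
      congruent (by (lemma x y u v) (ℤ.∣m∣n⇒∣m+n p q))
      where
      lemma : ∀ x y u v → (x ℤ.- y) ℤ.+ (u ℤ.- v) ≡ (x ℤ.+ u) ℤ.- (y ℤ.+ v)
      lemma = solve-∀

    ≡ₖ-neg : ∀ {x y} → x ≡ₖ y → - x ≡ₖ - y
    ≡ₖ-neg {x} {y} (congruent p) = congruent (by (lemma x y) (ℤ.∣m⇒∣-m p))
      where
      lemma : ∀ x y → - (x ℤ.- y) ≡ - x ℤ.- - y
      lemma = solve-∀

    ≡ₖ-- : ∀ {x y u v} → x ≡ₖ y → u ≡ₖ v → x ℤ.- u ≡ₖ y ℤ.- v
    ≡ₖ-- p q = ≡ₖ-+ p (≡ₖ-neg q)

  infixl 7 _∙ᴰ_

  -- Determined by s r^y = r^(-y) s and s² = e.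
  _∙ᴰ_ : Dih → Dih → Dih
  r^ x    ∙ᴰ r^ y    = r^ (x ℤ.+ y)
  r^ x    ∙ᴰ r^ y ·s = r^ (x ℤ.+ y) ·s
  r^ x ·s ∙ᴰ r^ y    = r^ (x ℤ.- y) ·s
  r^ x ·s ∙ᴰ r^ y ·s = r^ (x ℤ.- y)

  _⁻¹ᴰ : Dih → Dih
  (r^ x)    ⁻¹ᴰ = r^ (- x)
  (r^ x ·s) ⁻¹ᴰ = r^ x ·s

  private
    ≈-refl : ∀ {g} → g ≈ᴰ g
    ≈-refl {r^ x}    = rotation (≡ₖ-reflexive refl)
    ≈-refl {r^ x ·s} = reflection (≡ₖ-reflexive refl)

    ≈-sym : ∀ {g h} → g ≈ᴰ h → h ≈ᴰ g
    ≈-sym (rotation p)   = rotation (≡ₖ-sym p)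
    ≈-sym (reflection p) = reflection (≡ₖ-sym p)

    ≈-trans : ∀ {f g h} → f ≈ᴰ g → g ≈ᴰ h → f ≈ᴰ h
    ≈-trans (rotation p)   (rotation q)   = rotation (≡ₖ-trans p q)
    ≈-trans (reflection p) (reflection q) = reflection (≡ₖ-trans p q)

    ∙-cong : ∀ {f g h l} → f ≈ᴰ g → h ≈ᴰ l → f ∙ᴰ h ≈ᴰ g ∙ᴰ l
    ∙-cong (rotation p)   (rotation q)   = rotation (≡ₖ-+ p q)
    ∙-cong (rotation p)   (reflection q) = reflection (≡ₖ-+ p q)
    ∙-cong (reflection p) (rotation q)   = reflection (≡ₖ-- p q)
    ∙-cong (reflection p) (reflection q) = rotation (≡ₖ-- p q)

    ⁻¹-cong : ∀ {g h} → g ≈ᴰ h → g ⁻¹ᴰ ≈ᴰ h ⁻¹ᴰ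
    ⁻¹-cong (rotation p)   = rotation (≡ₖ-neg p)
    ⁻¹-cong (reflection p) = reflection p

    assoc₁ : ∀ x y z → (x ℤ.+ y) ℤ.+ z ≡ x ℤ.+ (y ℤ.+ z)
    assoc₁ = solve-∀
    assoc₂ : ∀ x y z → (x ℤ.+ y) ℤ.- z ≡ x ℤ.+ (y ℤ.- z)
    assoc₂ = solve-∀
    assoc₃ : ∀ x y z → (x ℤ.- y) ℤ.- z ≡ x ℤ.- (y ℤ.+ z)
    assoc₃ = solve-∀
    assoc₄ : ∀ x y z → (x ℤ.- y) ℤ.+ z ≡ x ℤ.- (y ℤ.- z)
    assoc₄ = solve-∀

    assoc : ∀ f g h → (f ∙ᴰ g) ∙ᴰ h ≈ᴰ f ∙ᴰ (g ∙ᴰ h)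
    assoc (r^ x)    (r^ y)    (r^ z)    = rotation   (≡ₖ-reflexive (assoc₁ x y z))
    assoc (r^ x)    (r^ y)    (r^ z ·s) = reflection (≡ₖ-reflexive (assoc₁ x y z))
    assoc (r^ x)    (r^ y ·s) (r^ z)    = reflection (≡ₖ-reflexive (assoc₂ x y z))
    assoc (r^ x)    (r^ y ·s) (r^ z ·s) = rotation   (≡ₖ-reflexive (assoc₂ x y z))
    assoc (r^ x ·s) (r^ y)    (r^ z)    = reflection (≡ₖ-reflexive (assoc₃ x y z))
    assoc (r^ x ·s) (r^ y)    (r^ z ·s) = rotation   (≡ₖ-reflexive (assoc₃ x y z))
    assoc (r^ x ·s) (r^ y ·s) (r^ z)    = rotation   (≡ₖ-reflexive (assoc₄ x y z))
    assoc (r^ x ·s) (r^ y ·s) (r^ z ·s) = reflection (≡ₖ-reflexive (assoc₄ x y z))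

    0+ : ∀ x → + 0 ℤ.+ x ≡ x
    0+ = solve-∀
    +0′ : ∀ x → x ℤ.+ + 0 ≡ x
    +0′ = solve-∀
    -0′ : ∀ x → x ℤ.- + 0 ≡ x
    -0′ = solve-∀
    -x+x : ∀ x → - x ℤ.+ x ≡ + 0
    -x+x = solve-∀
    x-x : ∀ x → x ℤ.- x ≡ + 0
    x-x = solve-∀

    identityˡ : ∀ g → r^ (+ 0) ∙ᴰ g ≈ᴰ g
    identityˡ (r^ x)    = rotation   (≡ₖ-reflexive (0+ x))
    identityˡ (r^ x ·s) = reflection (≡ₖ-reflexive (0+ x))

    identityʳ : ∀ g → g ∙ᴰ r^ (+ 0) ≈ᴰ g
    identityʳ (r^ x)    = rotation   (≡ₖ-reflexive (+0′ x))
    identityʳ (r^ x ·s) = reflection (≡ₖ-reflexive (-0′ x))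

    inverseˡ : ∀ g → g ⁻¹ᴰ ∙ᴰ g ≈ᴰ r^ (+ 0)
    inverseˡ (r^ x)    = rotation (≡ₖ-reflexive (-x+x x))
    inverseˡ (r^ x ·s) = rotation (≡ₖ-reflexive (x-x x))

    inverseʳ : ∀ g → g ∙ᴰ g ⁻¹ᴰ ≈ᴰ r^ (+ 0)
    inverseʳ (r^ x)    = rotation (≡ₖ-reflexive (x-x x))
    inverseʳ (r^ x ·s) = rotation (≡ₖ-reflexive (x-x x))

  dihedral : Group 0ℓ 0ℓ
  dihedral = record
    { Carrier = Dih
    ; _≈_     = _≈ᴰ_
    ; _∙_     = _∙ᴰ_
    ; ε       = r^ (+ 0)
    ; _⁻¹     = _⁻¹ᴰ
    ; isGroup = record
      { isMonoid = record
        { isSemigroup = record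
          { isMagma = record
            { isEquivalence = record { refl = ≈-refl ; sym = ≈-sym ; trans = ≈-trans }
            ; ∙-cong        = ∙-cong
            }
          ; assoc = assoc
          }
        ; identity = identityˡ , identityʳ
        }
      ; inverse = inverseˡ , inverseʳ
      ; ⁻¹-cong = ⁻¹-cong
      }
    }

infixl 6 _⊕_ _⊖_

_⊕_ : Fin n → ℕ → Fin n
_⊕_ {n} i d = _mod_ (toℕ i + d) n {{nonZeroIndex i}}

-- Subtraction without truncation: - d ≡ d (n - 1) modulo n.
_⊖_ : Fin n → ℕ → Fin n
_⊖_ {n} i d = i ⊕ d * (n ∸ 1)

module Construction {m : ℕ} (M : Array ℕ m) where

  D : Group 0ℓ 0ℓ
  D = dihedral (2 * (m * m))

  open Group D public using (_≈_; _∙_)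

  e o t : Fin m → Fin m → ℤ
  e i j = + (2 * M i j)
  o i j = + (2 * M i j + 1)
  t i j = - (+ (2 * M i j)) ℤ.+ + m ℤ.- + 2

  -- The off-diagonal cells (i , j) of Q¹² and Q²¹ that carry r^e s.
  eCell? : ∀ (i j : Fin m) →
           Dec ((Odd (toℕ i + toℕ j) × toℕ i < toℕ j) ⊎
                (Even (toℕ i + toℕ j) × toℕ j < toℕ i))
  eCell? i j =
    (¬? (2 ∣? (toℕ i + toℕ j)) ×-dec (toℕ i <? toℕ j)) ⊎-dec
    ((2 ∣? (toℕ i + toℕ j)) ×-dec (toℕ j <? toℕ i))

  -- The common pattern of Q¹² and Q²¹: the type of the entry is decided by the
  -- cell (i , j), its exponent is read from column j′ of M.  The last
  -- alternative is reached exactly when i + j is even and j ≥ i + 2, or i + j is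
  -- odd and j < i.
  mixed : (i j j′ : Fin m) → Dih
  mixed i j j′ =
    if does (j Fin.≟ i)    then r^ (o i j′) else
    if does (eCell? i j)   then r^ (e i j′) ·s
                           else r^ (t i j′) ·s

  Q¹¹ Q¹² Q²¹ Q²² : Array Dih m
  Q¹¹ i j = r^ (e i j)
  Q¹² i j = mixed i j j
  Q²¹ i j = mixed i j (j ⊕ 1)
  Q²² i j =
    if does (j Fin.≟ i)       then r^ (e i j) ·s else
    if does (j Fin.≟ (i ⊕ 1)) then r^ (t i j) ·s
                              else r^ (o i j)

  Q : Array Dih (m + m)
  Q = zipWith _++_ Q¹¹ Q¹² ++ zipWith _++_ Q²¹ Q²²

  -- The block labels 1 and 2 are represented by 0F and 1F; the parity of u + v
  -- is not affected.
  block : Fin 2 → Fin 2 → Array Dih m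
  block 0F 0F = Q¹¹
  block 0F 1F = Q¹²
  block 1F 0F = Q²¹
  block 1F 1F = Q²²

  ρ σ : Fin 2 → Fin 2 → Fin m → ℕ → Dih
  ρ u v i c = product D (toList (λ (k : Fin m) → block u v i (i ⊕ (c + toℕ k))))
  σ u v j c = product D (toList (λ (k : Fin m) → block u v (j ⊖ (c + toℕ k)) j))

  μ̃ : ℤ
  μ̃ = + magicConstant m

  -- (m - 2)(m - 1)/2; the division is exact.
  τ : ℤ
  τ = + (((m ∸ 2) * (m ∸ 1)) / 2)

  -- g is x when c is odd or zero, and y when c is even and non-zero.
  ByCase : ℕ → Dih → Dih → Dih → Set
  ByCase c g x y = (Odd c ⊎ c ≡ 0 → g ≈ x) × (Even c × c ≢ 0 → g ≈ y)

{-# OPTIONS --safe #-}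
module Submission where

-- Give every place of a product in D_k a sign that flips exactly at the
-- reflections.  If the exponents alternate compatibly with these signs, the
-- product telescopes to r^(± Σ), where Σ is the sum of the exponents taken
-- without signs.  Along a row or column of a block of Q, read cyclically, the
-- required sign is a function of the offset j - i modulo m only: in Q¹² and Q²¹
-- it is + at odd offsets and at 0, and - at the other even ones, and the place
-- where the reading starts decides between r^Σ and r^(-Σ).
--
-- The same offsets show that Q lists D_k: for each of the four kinds of entry
-- r^e, r^o, r^e s, r^t s, the cells of that kind in the two rows of Q with index
-- i read each cell of row i of M exactly once.

open import Defs
open import Algebra.Bundles using (Group)
import Algebra.Properties.CommutativeMonoid.Sum as Sum
import Algebra.Properties.Semiring.Sum as SemiringSum
open import Data.Bool using (true; false)
open import Data.Fin as Fin using (Fin; toℕ; fromℕ<; _↑ˡ_; _↑ʳ_)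
open import Data.Fin.Patterns using (0F; 1F)
open import Data.Fin.Permutation using (Permutation′; permutation; _⟨$⟩ʳ_)
open import Data.Fin.Properties
  using (toℕ-fromℕ<; toℕ-injective; toℕ<n; nonZeroIndex; splitAt⁻¹-↑ˡ; splitAt⁻¹-↑ʳ; splitAt-↑ˡ; splitAt-↑ʳ)
open import Data.Integer as ℤ using (ℤ; +_; -_; _+_; _-_; _*_; ∣_∣; _/ℕ_; _%ℕ_)
open import Data.Integer.DivMod using (a≡a%ℕn+[a/ℕn]*n; n%ℕd<d)
import Data.Integer.Divisibility.Signed as ℤ
import Data.Integer.Properties as ℤ
open import Data.Integer.Tactic.RingSolver using (solve-∀)
open import Data.List as List using (List; [_])
import Data.List.Properties as List
open import Data.List.Relation.Binary.Permutation.Propositional using (_↭_; ↭-sym; ↭-trans; ↭-reflexive)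
open import Data.List.Relation.Binary.Permutation.Propositional.Properties using (++-commutativeMonoid; ++⁺)
open import Data.Nat as ℕ using (ℕ; zero; suc; _≤_; _<_; NonZero; _%_; s≤s; z≤n)
open import Data.Nat.DivMod
  using (m≡m%n+[m/n]*n; m<n⇒m%n≡m; n%n≡0; %-distribˡ-+; m%n%n≡m%n; [m+n]%n≡m%n; [m+kn]%n≡m%n;
         m*n/n≡m; m%n<n; m≤n⇒[n∸m]%m≡n%m)
open import Data.Nat.Divisibility
  using (_∣_; divides; _∣?_; ∣m∣n⇒∣m+n; ∣m+n∣m⇒∣n; ∣1⇒≡1; n∣m*n; _∣0; >⇒∤; ∣⇒≤)
import Data.Nat.Properties as ℕ
import Data.Nat.Tactic.RingSolver as ℕ-Solver
open import Data.Product using (_×_; _,_; ∃₂; ∃-syntax; ∃!; proj₁; proj₂; uncurry)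
open import Data.Sign as Sign using (Sign)
open import Data.Sum using (_⊎_; inj₁; inj₂)
open import Data.Vec.Functional using (Vector; toList)
open import Function using (_∘_)
open import Level using (Level)
open import Relation.Binary.PropositionalEquality
  using (_≡_; _≢_; refl; sym; trans; cong; cong₂; subst; subst₂; module ≡-Reasoning)
open import Relation.Nullary using (yes; no; ¬_; contradiction; does)
open import Relation.Nullary.Decidable using (dec-true; dec-false)

-- Rows and columns share one argument: the n-th factor of a column product taken from `j` lies in
-- row `j - n`, so it again has offset n. For the result to depend on the starting sign alone, the
-- sign must return after a full turn. It does because every row of a block has an even number of
-- reflections: none in `Q¹¹`, two in `Q²²`, and `m - 1` in `Q¹²` and `Q²¹`, which is where `m` odd
-- enters. It matters which block has its starting point moved. In `Q²²` the sign is - only at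
-- offset 1, between the two reflections, so starting at any `c ≢ 1` gives `r^(2 μ̃)`. In the rows
-- with u = 2 the second constant therefore arises by starting `Q²¹`, not `Q²²`, at a non-zero even
-- offset, and in the columns with v = 2 by starting `Q¹²` there.

private
  module ℕ-Sum = Sum ℕ.+-0-commutativeMonoid

open Sum ℤ.+-0-commutativeMonoid using (sum; ∑-distrib-+; sum-permute; sum-cong-≗; sum-replicate-zero)
open SemiringSum ℤ.+-*-semiring using (*-distribˡ-sum)

private
  variable
    a ℓ : Level

-- Cyclic index arithmetic

module _ {m : ℕ} where

  private
    %-absorbˡ : ∀ a b .{{_ : NonZero m}} → (a % m ℕ.+ b) % m ≡ (a ℕ.+ b) % m
    %-absorbˡ a b = begin
      (a % m ℕ.+ b) % m            ≡⟨ %-distribˡ-+ (a % m) b m ⟩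
      (a % m % m ℕ.+ b % m) % m    ≡⟨ cong (λ x → (x ℕ.+ b % m) % m) (m%n%n≡m%n a m) ⟩
      (a % m ℕ.+ b % m) % m        ≡⟨ %-distribˡ-+ a b m ⟨
      (a ℕ.+ b) % m                ∎
      where open ≡-Reasoning

  toℕ-⊕ : ∀ (i : Fin m) a .{{_ : NonZero m}} → toℕ (i ⊕ a) ≡ (toℕ i ℕ.+ a) % m
  toℕ-⊕ i a = toℕ-fromℕ< _

  ⊕-assoc : ∀ (i : Fin m) a b → i ⊕ a ⊕ b ≡ i ⊕ (a ℕ.+ b)
  ⊕-assoc i a b = toℕ-injective (begin
    toℕ (i ⊕ a ⊕ b)                    ≡⟨ toℕ-⊕ (i ⊕ a) b ⟩
    (toℕ (i ⊕ a) ℕ.+ b) % m            ≡⟨ cong (λ x → (x ℕ.+ b) % m) (toℕ-⊕ i a) ⟩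
    ((toℕ i ℕ.+ a) % m ℕ.+ b) % m      ≡⟨ %-absorbˡ (toℕ i ℕ.+ a) b ⟩
    (toℕ i ℕ.+ a ℕ.+ b) % m            ≡⟨ cong (_% m) (ℕ.+-assoc (toℕ i) a b) ⟩
    (toℕ i ℕ.+ (a ℕ.+ b)) % m          ≡⟨ toℕ-⊕ i (a ℕ.+ b) ⟨
    toℕ (i ⊕ (a ℕ.+ b))                ∎)
    where
    open ≡-Reasoning
    instance _ = nonZeroIndex i

  ⊕-multiple : ∀ (i : Fin m) q → i ⊕ q ℕ.* m ≡ i
  ⊕-multiple i q = toℕ-injective (begin
    toℕ (i ⊕ q ℕ.* m)        ≡⟨ toℕ-⊕ i (q ℕ.* m) ⟩
    (toℕ i ℕ.+ q ℕ.* m) % m  ≡⟨ [m+kn]%n≡m%n (toℕ i) q m ⟩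
    toℕ i % m                ≡⟨ m<n⇒m%n≡m (toℕ<n i) ⟩
    toℕ i                    ∎)
    where
    open ≡-Reasoning
    instance _ = nonZeroIndex i

  ⊕-identityʳ : ∀ (i : Fin m) → i ⊕ 0 ≡ i
  ⊕-identityʳ i = ⊕-multiple i 0

  ⊕-% : ∀ (i : Fin m) n .{{_ : NonZero m}} → i ⊕ n % m ≡ i ⊕ n
  ⊕-% i n = begin
    i ⊕ n % m                        ≡⟨ ⊕-multiple (i ⊕ n % m) (n ℕ./ m) ⟨
    i ⊕ n % m ⊕ n ℕ./ m ℕ.* m        ≡⟨ ⊕-assoc i (n % m) (n ℕ./ m ℕ.* m) ⟩
    i ⊕ (n % m ℕ.+ n ℕ./ m ℕ.* m)    ≡⟨ cong (i ⊕_) (m≡m%n+[m/n]*n n m) ⟨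
    i ⊕ n                            ∎
    where open ≡-Reasoning

  -- Exchanging base point and displacement lets `⊖`, which cancels displacements, cancel base
  -- points as well.
  ⊕-exchange : ∀ (i j : Fin m) c → i ⊕ (c ℕ.+ toℕ j) ≡ j ⊕ (c ℕ.+ toℕ i)
  ⊕-exchange i j c = toℕ-injective (begin
    toℕ (i ⊕ (c ℕ.+ toℕ j))          ≡⟨ toℕ-⊕ i (c ℕ.+ toℕ j) ⟩
    (toℕ i ℕ.+ (c ℕ.+ toℕ j)) % m    ≡⟨ cong (_% m) (swap-outer (toℕ i) c (toℕ j)) ⟩
    (toℕ j ℕ.+ (c ℕ.+ toℕ i)) % m    ≡⟨ toℕ-⊕ j (c ℕ.+ toℕ i) ⟨
    toℕ (j ⊕ (c ℕ.+ toℕ i))          ∎)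
    where
    open ≡-Reasoning
    instance _ = nonZeroIndex i
    swap-outer : ∀ x y z → x ℕ.+ (y ℕ.+ z) ≡ z ℕ.+ (y ℕ.+ x)
    swap-outer = ℕ-Solver.solve-∀

  ⊖-⊕ : ∀ (i : Fin m) b → i ⊖ b ⊕ b ≡ i
  ⊖-⊕ i b = begin
    i ⊖ b ⊕ b                            ≡⟨ ⊕-assoc i (b ℕ.* (m ℕ.∸ 1)) b ⟩
    i ⊕ (b ℕ.* (m ℕ.∸ 1) ℕ.+ b)          ≡⟨ cong (i ⊕_) (trans (ℕ.+-comm (b ℕ.* (m ℕ.∸ 1)) b)
                                              (sym (ℕ.*-suc b (m ℕ.∸ 1)))) ⟩
    i ⊕ b ℕ.* suc (ℕ.pred m)             ≡⟨ cong (λ n → i ⊕ b ℕ.* n) (ℕ.suc-pred m) ⟩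
    i ⊕ b ℕ.* m                          ≡⟨ ⊕-multiple i b ⟩
    i                                    ∎
    where
    open ≡-Reasoning
    instance _ = nonZeroIndex i

  ⊕-⊖ : ∀ (i : Fin m) b → i ⊕ b ⊖ b ≡ i
  ⊕-⊖ i b = begin
    i ⊕ b ⊖ b                            ≡⟨ ⊕-assoc i b _ ⟩
    i ⊕ (b ℕ.+ b ℕ.* (m ℕ.∸ 1))          ≡⟨ cong (i ⊕_) (ℕ.+-comm b _) ⟩
    i ⊕ (b ℕ.* (m ℕ.∸ 1) ℕ.+ b)          ≡⟨ ⊕-assoc i _ b ⟨
    i ⊖ b ⊕ b                            ≡⟨ ⊖-⊕ i b ⟩
    i                                    ∎
    where open ≡-Reasoning

  ⊕-injectiveʳ : ∀ (i : Fin m) {a b} → a < m → b < m → i ⊕ a ≡ i ⊕ b → a ≡ b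
  ⊕-injectiveʳ i {a} {b} a<m b<m eq = begin
    a                   ≡⟨ toℕ-fromℕ< a<m ⟨
    toℕ (fromℕ< a<m)    ≡⟨ cong toℕ equal ⟩
    toℕ (fromℕ< b<m)    ≡⟨ toℕ-fromℕ< b<m ⟩
    b                   ∎
    where
    open ≡-Reasoning
    flip-⊕ : ∀ {c} (c<m : c < m) → i ⊕ c ≡ fromℕ< c<m ⊕ toℕ i
    flip-⊕ c<m = trans (cong (i ⊕_) (sym (toℕ-fromℕ< c<m))) (⊕-exchange i (fromℕ< c<m) 0)
    equal : fromℕ< a<m ≡ fromℕ< b<m
    equal = begin
      fromℕ< a<m                   ≡⟨ ⊕-⊖ _ (toℕ i) ⟨
      fromℕ< a<m ⊕ toℕ i ⊖ toℕ i   ≡⟨ cong (_⊖ toℕ i) (trans (sym (flip-⊕ a<m)) (trans eq (flip-⊕ b<m))) ⟩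
      fromℕ< b<m ⊕ toℕ i ⊖ toℕ i   ≡⟨ ⊕-⊖ _ (toℕ i) ⟩
      fromℕ< b<m                   ∎

  offset : Fin m → Fin m → ℕ
  offset i j = toℕ (j ⊖ toℕ i)

  offset<m : ∀ i j → offset i j < m
  offset<m i j = toℕ<n (j ⊖ toℕ i)

  ⊕-offset : ∀ i j → i ⊕ offset i j ≡ j
  ⊕-offset i j = trans (⊕-exchange i (j ⊖ toℕ i) 0) (⊖-⊕ j (toℕ i))

  -- The reading order of `ρ`. By `⊕-exchange` it translates `k` by `c + toℕ i`, so the opposite
  -- translation inverts it.
  rotation-permutation : Fin m → ℕ → Permutation′ m
  rotation-permutation i c = permutation (λ k → i ⊕ (c ℕ.+ toℕ k)) (_⊖ (c ℕ.+ toℕ i))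
    (λ k → trans (⊕-exchange i _ c) (⊖-⊕ k (c ℕ.+ toℕ i)))
    (λ k → trans (cong (_⊖ (c ℕ.+ toℕ i)) (⊕-exchange i k c)) (⊕-⊖ k (c ℕ.+ toℕ i)))

  -- The reading order of `σ`. The map taking k to j - c - k is an involution.
  reflection-permutation : Fin m → ℕ → Permutation′ m
  reflection-permutation j c = permutation f f f∘f f∘f
    where
    open ≡-Reasoning
    f : Fin m → Fin m
    f k = j ⊖ (c ℕ.+ toℕ k)
    f∘f : ∀ k → f (f k) ≡ k
    f∘f k = begin
      j ⊖ (c ℕ.+ toℕ (f k))                            ≡⟨ cong (_⊖ (c ℕ.+ toℕ (f k))) (⊖-⊕ j (c ℕ.+ toℕ k)) ⟨
      f k ⊕ (c ℕ.+ toℕ k) ⊖ (c ℕ.+ toℕ (f k))          ≡⟨ cong (_⊖ (c ℕ.+ toℕ (f k))) (⊕-exchange (f k) k c) ⟩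
      k ⊕ (c ℕ.+ toℕ (f k)) ⊖ (c ℕ.+ toℕ (f k))        ≡⟨ ⊕-⊖ k (c ℕ.+ toℕ (f k)) ⟩
      k                                                ∎

-- Tabulated lists up to permutation

module _ {A : Set} where

  private
    module ListSum = Sum (++-commutativeMonoid {A = A})

  toList≡sum : ∀ {n} (f : Vector A n) → ListSum.sum (λ i → [ f i ]) ≡ toList f
  toList≡sum {zero}  f = refl
  toList≡sum {suc n} f = cong (f Fin.zero List.∷_) (toList≡sum (f ∘ Fin.suc))

  -- Lists up to permutation form a commutative monoid, in which toList f is
  -- the sum of the singletons [ f i ].
  toList-permute : ∀ {n} (f : Vector A n) (π : Permutation′ n) →
                   toList (λ i → f (π ⟨$⟩ʳ i)) ↭ toList f
  toList-permute f π = subst₂ _↭_ (toList≡sum (λ i → f (π ⟨$⟩ʳ i))) (toList≡sum f)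
    (↭-sym (ListSum.sum-permute (λ i → [ f i ]) π))

-- Parity of natural numbers

odd-suc : ∀ {n} → Even n → Odd (suc n)
odd-suc {n} 2∣n 2∣1+n with ∣1⇒≡1 (∣m+n∣m⇒∣n (subst (2 ∣_) (ℕ.+-comm 1 n) 2∣1+n) 2∣n)
... | ()

even-suc : ∀ {n} → Odd n → Even (suc n)
even-suc {zero}        odd = contradiction (2 ∣0) odd
even-suc {suc zero}    odd = divides 1 refl
even-suc {suc (suc n)} odd = ∣m∣n⇒∣m+n (divides 1 refl) (even-suc (odd ∘ ∣m∣n⇒∣m+n (divides 1 refl)))

odd-pred : ∀ {n} → Even (suc n) → Odd n
odd-pred 2∣1+n 2∣n = odd-suc 2∣n 2∣1+n

even-pred : ∀ {n} → Odd (suc n) → Even n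
even-pred {n} odd with 2 ∣? n
... | yes 2∣n = 2∣n
... | no  2∤n = contradiction (even-suc 2∤n) odd

odd+odd : ∀ {a b} → Odd a → Odd b → Even (a ℕ.+ b)
odd+odd {a} {zero}  _    odd = contradiction (2 ∣0) odd
odd+odd {a} {suc b} odda oddb = subst (2 ∣_) (sym (ℕ.+-suc a b))
  (∣m∣n⇒∣m+n (even-suc odda) (even-pred oddb))

-- In this form `m ∸ 2` and `m ∸ 1` compute to `suc (h * 2)` and `suc h * 2`, so the truncated
-- subtractions and the halving in `τ` become harmless.
odd-form : ∀ {m} → 3 ≤ m → Odd m → ∃[ h ] m ≡ 3 ℕ.+ h ℕ.* 2
odd-form (s≤s (s≤s (s≤s (z≤n {n})))) odd with 2 ∣? n
... | yes (divides h n≡h*2) = h , cong (3 ℕ.+_) n≡h*2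
... | no  2∤n               = contradiction (even-suc (odd-suc (even-suc 2∤n))) odd

-- Alternating sequences and telescoping products

alternate : ∀ {A : Set} → A → A → ℕ → A
alternate x y zero    = x
alternate x y (suc n) = alternate y x n

alternate-even : ∀ {A : Set} {x y : A} {n} → Even n → alternate x y n ≡ x
alternate-odd  : ∀ {A : Set} {x y : A} {n} → Odd n → alternate x y n ≡ y

alternate-even {n = zero}  _    = refl
alternate-even {n = suc n} even = alternate-odd (odd-pred even)

alternate-odd {n = zero}  odd = contradiction (2 ∣0) odd
alternate-odd {n = suc n} odd = alternate-even (even-pred odd)

-- The factor that adds x to the exponent Σ of a product r^(± Σ) or r^(± Σ) s,
-- at a place where the sign is p before the factor and q after it.
step : Sign → Sign → ℤ → Dih
step Sign.+ Sign.+ x = r^ x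
step Sign.+ Sign.- x = r^ x ·s
step Sign.- Sign.+ x = r^ (- x) ·s
step Sign.- Sign.- x = r^ (- x)

module _ (k : ℕ) where

  step-zero : ∀ p → r^ (+ 0) ≡ step p p (+ 0)
  step-zero Sign.+ = refl
  step-zero Sign.- = refl

  private
    neg-+ : ∀ x y → - x + - y ≡ - (x + y)
    neg-+ = solve-∀
    neg-neg : ∀ x y → x - - y ≡ x + y
    neg-neg = solve-∀

  -- A reflection negates every exponent to its right, since s r^y = r^(-y) s. The minus signs built
  -- into `step` undo exactly this, so the intermediate sign `q` drops out.
  step-∙ : ∀ p q s x y → _∙ᴰ_ k (step p q x) (step q s y) ≡ step p s (x + y)
  step-∙ Sign.+ Sign.+ Sign.+ x y = refl
  step-∙ Sign.+ Sign.+ Sign.- x y = refl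
  step-∙ Sign.+ Sign.- Sign.+ x y = cong r^_ (neg-neg x y)
  step-∙ Sign.+ Sign.- Sign.- x y = cong r^_·s (neg-neg x y)
  step-∙ Sign.- Sign.+ Sign.+ x y = cong r^_·s (neg-+ x y)
  step-∙ Sign.- Sign.+ Sign.- x y = cong r^_ (neg-+ x y)
  step-∙ Sign.- Sign.- Sign.+ x y = cong r^_·s (neg-+ x y)
  step-∙ Sign.- Sign.- Sign.- x y = cong r^_ (neg-+ x y)

  product-step : ∀ (s : ℕ → Sign) n (x : Vector ℤ n) →
                 product (dihedral k) (toList (λ i → step (s (toℕ i)) (s (suc (toℕ i))) (x i)))
                 ≡ step (s 0) (s n) (sum x)
  product-step s zero    x = step-zero (s 0)
  product-step s (suc n) x = trans
    (cong (_∙ᴰ_ k (step (s 0) (s 1) (x 0F))) (product-step (s ∘ suc) n (x ∘ Fin.suc)))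
    (step-∙ (s 0) (s 1) (s (suc n)) (x 0F) (sum (x ∘ Fin.suc)))

sum-+ : ∀ {n} (f : Vector ℕ n) → sum (λ i → + f i) ≡ + ℕ-Sum.sum f
sum-+ {zero}  f = refl
sum-+ {suc n} f = cong (λ n → + f 0F + n) (sum-+ (f ∘ Fin.suc))

-- The starting point `c` survives only in the sign: a window of `m` consecutive places meets every
-- residue once, so the weights `w` always have the same total, and after `m` steps the sign is back
-- at `φ (c % m)`.
cyclic-product : ∀ {m} {K} .{{_ : NonZero m}} (φ : ℕ → Sign) (w : ℕ → ℤ) (f : ℕ → ℕ) (G : ℕ → Dih) {S} →
                 (∀ n → G n ≡ step (φ (n % m)) (φ (suc n % m)) (+ 2 * + f n + w (n % m))) →
                 ∀ c → ℕ-Sum.sum (λ (k : Fin m) → f (c ℕ.+ toℕ k)) ≡ S →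
                 product (dihedral K) (toList (λ (k : Fin m) → G (c ℕ.+ toℕ k)))
                 ≡ step (φ (c % m)) (φ (c % m)) (+ 2 * + S + sum (λ (k : Fin m) → w (toℕ k)))
cyclic-product {m} {K} φ w f G {S} G-step c Σf≡S = begin
  product (dihedral K) (toList (λ (k : Fin m) → G (c ℕ.+ toℕ k)))
    ≡⟨ cong (product (dihedral K)) (List.tabulate-cong factor) ⟩
  product (dihedral K) (toList (λ (k : Fin m) → step (s (toℕ k)) (s (suc (toℕ k))) (x k)))
    ≡⟨ product-step K s m x ⟩
  step (s 0) (s m) (sum x)
    ≡⟨ cong₂ (λ a b → step (φ (a % m)) (φ b) (sum x)) (ℕ.+-identityʳ c) ([m+n]%n≡m%n c m) ⟩
  step (φ (c % m)) (φ (c % m)) (sum x)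
    ≡⟨ cong (step (φ (c % m)) (φ (c % m))) Σx ⟩
  step (φ (c % m)) (φ (c % m)) (+ 2 * + S + sum (λ (k : Fin m) → w (toℕ k))) ∎
  where
  open ≡-Reasoning
  s : ℕ → Sign
  s n = φ ((c ℕ.+ n) % m)
  x : Vector ℤ m
  x k = + 2 * + f (c ℕ.+ toℕ k) + w ((c ℕ.+ toℕ k) % m)
  factor : ∀ k → G (c ℕ.+ toℕ k) ≡ step (s (toℕ k)) (s (suc (toℕ k))) (x k)
  factor k = trans (G-step (c ℕ.+ toℕ k))
    (cong (λ n → step (s (toℕ k)) (φ (n % m)) (x k)) (sym (ℕ.+-suc c (toℕ k))))
  0<m : 0 < m
  0<m = ℕ.>-nonZero⁻¹ m
  first : Fin m
  first = fromℕ< 0<m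
  -- Residues are recast as cyclic translates of index 0, so that the sum of weights can be
  -- permuted.
  window : ∀ k → (c ℕ.+ toℕ k) % m ≡ toℕ (first ⊕ (c ℕ.+ toℕ k))
  window k = sym (trans (toℕ-⊕ first (c ℕ.+ toℕ k))
    (cong (λ n → (n ℕ.+ (c ℕ.+ toℕ k)) % m) (toℕ-fromℕ< 0<m)))
  Σx : sum x ≡ + 2 * + S + sum (λ (k : Fin m) → w (toℕ k))
  Σx = begin
    sum x
      ≡⟨ ∑-distrib-+ {m} (λ k → + 2 * + f (c ℕ.+ toℕ k)) _ ⟩
    sum (λ (k : Fin m) → + 2 * + f (c ℕ.+ toℕ k)) + sum (λ (k : Fin m) → w ((c ℕ.+ toℕ k) % m))
      ≡⟨ cong₂ _+_ (sym (*-distribˡ-sum {m} (+ 2) (λ k → + f (c ℕ.+ toℕ k)))) (sum-cong-≗ {m} (cong w ∘ window)) ⟩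
    + 2 * sum (λ (k : Fin m) → + f (c ℕ.+ toℕ k)) + sum (λ (k : Fin m) → w (toℕ (first ⊕ (c ℕ.+ toℕ k))))
      ≡⟨ cong₂ (λ a b → + 2 * a + b) (trans (sum-+ {m} (λ k → f (c ℕ.+ toℕ k))) (cong +_ Σf≡S))
           (sym (sum-permute {m} {m} (w ∘ toℕ) (rotation-permutation first c))) ⟩
    + 2 * + S + sum (λ (k : Fin m) → w (toℕ k)) ∎

-- The four kinds of entries and their places

data Kind : Set where
  E O S T : Kind

-- Column offsets of kind T are counted from 1 to m, all others from 0 to m - 1,
-- so that no offset has to be reduced modulo m in Cell.
base : Kind → ℕ
base T = 1
base _ = 0

-- Cell u v d κ k: for every i, the entry of block (u , v) in row i and column
-- i + d is of kind κ and has its exponent read from column i + base κ + k of M.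
data Cell : Fin 2 → Fin 2 → ℕ → Kind → ℕ → Set where
  e₀ : ∀ {d} → Cell 0F 0F d E d
  o₀ : Cell 0F 1F 0 O 0
  o₁ : Cell 1F 0F 0 O 1
  o₂ : ∀ {d} → Cell 1F 1F (2 ℕ.+ d) O (2 ℕ.+ d)
  s₀ : Cell 1F 1F 0 S 0
  s₁ : ∀ {d} → Odd d → Cell 0F 1F d S d
  s₂ : ∀ {d} → Odd d → Cell 1F 0F d S (suc d)
  t₀ : Cell 1F 1F 1 T 0
  t₁ : ∀ {d} → Odd d → Cell 0F 1F (suc d) T d
  t₂ : ∀ {d} → Odd d → Cell 1F 0F (suc d) T (suc d)

cell : ∀ u v d → ∃₂ λ κ k → Cell u v d κ k
cell 0F 0F d             = E , _ , e₀
cell 1F 1F 0             = S , _ , s₀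
cell 1F 1F 1             = T , _ , t₀
cell 1F 1F (suc (suc d)) = O , _ , o₂
cell 0F 1F zero          = O , _ , o₀
cell 0F 1F (suc d) with 2 ∣? d
... | yes even = S , _ , s₁ (odd-suc even)
... | no  odd  = T , _ , t₁ odd
cell 1F 0F zero          = O , _ , o₁
cell 1F 0F (suc d) with 2 ∣? d
... | yes even = S , _ , s₂ (odd-suc even)
... | no  odd  = T , _ , t₂ odd

shift : Fin 2 → Fin 2 → ℕ
shift 1F 0F = 1
shift _  _  = 0

base-slot : ∀ {u v d κ k} → Cell u v d κ k → base κ ℕ.+ k ≡ shift u v ℕ.+ d
base-slot e₀     = refl
base-slot o₀     = refl
base-slot o₁     = refl
base-slot o₂     = refl
base-slot s₀     = refl
base-slot (s₁ _) = refl
base-slot (s₂ _) = refl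
base-slot t₀     = refl
base-slot (t₁ _) = refl
base-slot (t₂ _) = refl

-- Within a kind the slot reveals the block. For `S` and `T`, slot 0 belongs to `Q²²`, odd slots to
-- `Q¹²` and positive even slots to `Q²¹`; for `O`, slots 0 and 1 belong to `Q¹²` and `Q²¹`, the
-- others to `Q²²`.
cell-unique : ∀ {u v d u′ v′ d′ κ k} → Cell u v d κ k → Cell u′ v′ d′ κ k →
              (u , v , d) ≡ (u′ , v′ , d′)
cell-unique e₀     e₀     = refl
cell-unique o₀     o₀     = refl
cell-unique o₁     o₁     = refl
cell-unique o₂     o₂     = refl
cell-unique s₀     s₀     = refl
cell-unique s₀     (s₁ p) = contradiction (2 ∣0) p
cell-unique (s₁ p) s₀     = contradiction (2 ∣0) p
cell-unique (s₁ _) (s₁ _) = refl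
cell-unique (s₁ p) (s₂ q) = contradiction (even-suc q) p
cell-unique (s₂ q) (s₁ p) = contradiction (even-suc q) p
cell-unique (s₂ _) (s₂ _) = refl
cell-unique t₀     t₀     = refl
cell-unique t₀     (t₁ p) = contradiction (2 ∣0) p
cell-unique (t₁ p) t₀     = contradiction (2 ∣0) p
cell-unique (t₁ _) (t₁ _) = refl
cell-unique (t₁ p) (t₂ q) = contradiction (even-suc q) p
cell-unique (t₂ q) (t₁ p) = contradiction (even-suc q) p
cell-unique (t₂ _) (t₂ _) = refl

module _ {m : ℕ} (odd-m : Odd m) (1<m : 1 < m) where

  -- The last index `m - 1` is even, so an odd index is never the last.
  suc-odd<m : ∀ {k} → Odd k → k < m → suc k < m
  suc-odd<m odd k<m = ℕ.≤∧≢⇒< k<m (λ { refl → odd-m (even-suc odd) })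

  -- The existence half of the count whose uniqueness half is `cell-unique`: each kind fills all
  -- slots below `m`.
  cell-at : ∀ κ k → k < m → ∃₂ λ u v → ∃[ d ] (d < m × Cell u v d κ k)
  cell-at E k             k<m = 0F , 0F , k , k<m , e₀
  cell-at O 0             k<m = 0F , 1F , 0 , k<m , o₀
  cell-at O 1             k<m = 1F , 0F , 0 , ℕ.<-trans (s≤s z≤n) k<m , o₁
  cell-at O (suc (suc k)) k<m = 1F , 1F , _ , k<m , o₂
  cell-at S zero          k<m = 1F , 1F , _ , k<m , s₀
  cell-at S (suc k)       k<m with 2 ∣? k
  ... | yes even = 0F , 1F , _ , k<m , s₁ (odd-suc even)
  ... | no  odd  = 1F , 0F , _ , ℕ.<-trans (ℕ.n<1+n k) k<m , s₂ odd
  cell-at T zero          k<m = 1F , 1F , 1 , 1<m , t₀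
  cell-at T (suc k)       k<m with 2 ∣? k
  ... | yes even = 0F , 1F , _ , suc-odd<m (odd-suc even) k<m , t₁ (odd-suc even)
  ... | no  odd  = 1F , 0F , _ , k<m , t₂ odd

  slot<m : ∀ {u v d κ k} → Cell u v d κ k → d < m → k < m
  slot<m e₀       d<m = d<m
  slot<m o₀       d<m = d<m
  slot<m o₁       d<m = 1<m
  slot<m o₂       d<m = d<m
  slot<m s₀       d<m = d<m
  slot<m (s₁ _)   d<m = d<m
  slot<m (s₂ odd) d<m = suc-odd<m odd d<m
  slot<m t₀       d<m = ℕ.<-trans (ℕ.n<1+n 0) d<m
  slot<m (t₁ _)   d<m = ℕ.<-trans (ℕ.n<1+n _) d<m
  slot<m (t₂ _)   d<m = d<m

-- Signs and weights by offset

mixedPhase : ℕ → Sign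
mixedPhase zero    = Sign.+
mixedPhase (suc d) = alternate Sign.+ Sign.- d

mixedPhase-odd : ∀ {c} → Odd c ⊎ c ≡ 0 → mixedPhase c ≡ Sign.+
mixedPhase-odd {zero}  _          = refl
mixedPhase-odd {suc c} (inj₁ odd) = alternate-even (even-pred odd)

mixedPhase-even : ∀ {c} → Even c × c ≢ 0 → mixedPhase c ≡ Sign.-
mixedPhase-even {zero}  (_ , c≢0)  = contradiction refl c≢0
mixedPhase-even {suc c} (even , _) = alternate-odd (odd-pred even)

-- The sign in front of the entry at the given offset. `Q²²` has its reflections at offsets 0 and 1,
-- so only the gap between them is negative.
phase : Fin 2 → Fin 2 → ℕ → Sign
phase 0F 0F _ = Sign.+
phase 1F 1F 1 = Sign.-
phase 1F 1F _ = Sign.+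
phase _  _  d = mixedPhase d

module _ (m : ℕ) where

  value : Kind → ℕ → Dih
  value E x = r^ (+ (2 ℕ.* x))
  value O x = r^ (+ (2 ℕ.* x ℕ.+ 1))
  value S x = r^ (+ (2 ℕ.* x)) ·s
  value T x = r^ (- (+ (2 ℕ.* x)) + + m - + 2) ·s

  mixedWeight : ℕ → ℤ
  mixedWeight zero    = + 1
  mixedWeight (suc d) = alternate (+ 0) (- (+ m - + 2)) d

  -- What remains of an unsigned exponent after removing twice the entry of the magic square: 0 for
  -- r^e and r^e s, 1 for r^o, and -(m - 2) for r^t s.
  weight : Fin 2 → Fin 2 → ℕ → ℤ
  weight 0F 0F _ = + 0
  weight 1F 1F 0 = + 0
  weight 1F 1F 1 = - (+ m - + 2)
  weight 1F 1F _ = + 1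
  weight _  _  d = mixedWeight d

  private
    e-exponent : ∀ x → + (2 ℕ.* x) ≡ + 2 * + x + + 0
    e-exponent x = trans (ℤ.pos-* 2 x) (sym (ℤ.+-identityʳ _))
    o-exponent : ∀ x → + (2 ℕ.* x ℕ.+ 1) ≡ + 2 * + x + + 1
    o-exponent x = cong (_+ + 1) (ℤ.pos-* 2 x)
    t-exponent : ∀ x → - (+ (2 ℕ.* x)) + + m - + 2 ≡ - (+ 2 * + x + - (+ m - + 2))
    t-exponent x = trans (cong (λ y → - y + + m - + 2) (ℤ.pos-* 2 x)) (lemma (+ 2 * + x) (+ m))
      where
      lemma : ∀ x y → - x + y - + 2 ≡ - (x + - (y - + 2))
      lemma = solve-∀

  -- Reflections r^e s and r^t s alternate: the former turn + into -, the latter turn - back into +.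
  -- The exponent t is the negative of 2x - (m - 2), as a place with sign - in front demands, while
  -- every r^e and r^o stands where the sign is +.
  value-step : ∀ {u v d κ k} x → Cell u v d κ k →
               value κ x ≡ step (phase u v d) (phase u v (suc d)) (+ 2 * + x + weight u v d)
  value-step x e₀ = cong r^_ (e-exponent x)
  value-step x o₀ = cong r^_ (o-exponent x)
  value-step x o₁ = cong r^_ (o-exponent x)
  value-step x o₂ = cong r^_ (o-exponent x)
  value-step x s₀ = cong r^_·s (e-exponent x)
  value-step x t₀ = cong r^_·s (t-exponent x)
  value-step x (s₁ {zero}  odd) = contradiction (2 ∣0) odd
  value-step x (s₁ {suc d} odd)
    rewrite alternate-even {x = Sign.+} {Sign.-} (even-pred odd)
          | alternate-even {x = Sign.-} {Sign.+} (even-pred odd)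
          | alternate-even {x = + 0} { - (+ m - + 2)} (even-pred odd)
    = cong r^_·s (e-exponent x)
  value-step x (s₂ {zero}  odd) = contradiction (2 ∣0) odd
  value-step x (s₂ {suc d} odd)
    rewrite alternate-even {x = Sign.+} {Sign.-} (even-pred odd)
          | alternate-even {x = Sign.-} {Sign.+} (even-pred odd)
          | alternate-even {x = + 0} { - (+ m - + 2)} (even-pred odd)
    = cong r^_·s (e-exponent x)
  value-step x (t₁ odd)
    rewrite alternate-odd {x = Sign.+} {Sign.-} odd
          | alternate-odd {x = Sign.-} {Sign.+} odd
          | alternate-odd {x = + 0} { - (+ m - + 2)} odd
    = cong r^_·s (t-exponent x)
  value-step x (t₂ odd)
    rewrite alternate-odd {x = Sign.+} {Sign.-} odd
          | alternate-odd {x = Sign.-} {Sign.+} odd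
          | alternate-odd {x = + 0} { - (+ m - + 2)} odd
    = cong r^_·s (t-exponent x)

-- Total weights of the blocks

sum-alternate : ∀ h a → sum (λ (k : Fin (h ℕ.* 2)) → alternate (+ 0) a (toℕ k)) ≡ + h * a
sum-alternate zero    a = sym (ℤ.*-zeroˡ a)
sum-alternate (suc h) a = begin
  + 0 + (a + sum (λ (k : Fin (h ℕ.* 2)) → alternate (+ 0) a (toℕ k)))   ≡⟨ ℤ.+-identityˡ _ ⟩
  a + sum (λ (k : Fin (h ℕ.* 2)) → alternate (+ 0) a (toℕ k))           ≡⟨ cong (λ x → a + x) (sum-alternate h a) ⟩
  a + + h * a                                                          ≡⟨ lemma a (+ h) ⟩
  (+ 1 + + h) * a                                                      ∎
  where
  open ≡-Reasoning
  lemma : ∀ a h → a + h * a ≡ (+ 1 + h) * a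
  lemma = solve-∀

sum-ones : ∀ n → sum (λ (k : Fin n) → + 1) ≡ + n
sum-ones zero    = refl
sum-ones (suc n) = cong (λ x → + 1 + x) (sum-ones n)

module _ (h : ℕ) where

  private
    m : ℕ
    m = 3 ℕ.+ h ℕ.* 2

  τ-value : ((m ℕ.∸ 2) ℕ.* (m ℕ.∸ 1)) ℕ./ 2 ≡ suc (h ℕ.* 2) ℕ.* suc h
  τ-value = trans (cong (ℕ._/ 2) (sym (ℕ.*-assoc (suc (h ℕ.* 2)) (suc h) 2))) (m*n/n≡m (suc (h ℕ.* 2) ℕ.* suc h) 2)

  -- The second factor is half of m² + 1 = 10 + 12h + 4h².
  magicConstant-value : magicConstant m ≡ m ℕ.* (5 ℕ.+ h ℕ.* 6 ℕ.+ h ℕ.* h ℕ.* 2)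
  magicConstant-value = trans (cong (ℕ._/ 2) (lemma h)) (m*n/n≡m (m ℕ.* (5 ℕ.+ h ℕ.* 6 ℕ.+ h ℕ.* h ℕ.* 2)) 2)
    where
    lemma : ∀ h → (3 ℕ.+ h ℕ.* 2) ℕ.* ((3 ℕ.+ h ℕ.* 2) ℕ.* (3 ℕ.+ h ℕ.* 2) ℕ.+ 1)
                ≡ (3 ℕ.+ h ℕ.* 2) ℕ.* (5 ℕ.+ h ℕ.* 6 ℕ.+ h ℕ.* h ℕ.* 2) ℕ.* 2
    lemma = ℕ-Solver.solve-∀

  -- The origin of `τ`: the single r^o contributes 1, and each of the (m - 1)/2 entries r^t s
  -- contributes -(m - 2).
  sum-mixedWeight : sum (λ (k : Fin m) → mixedWeight m (toℕ k))
                    ≡ + 1 - + (((m ℕ.∸ 2) ℕ.* (m ℕ.∸ 1)) ℕ./ 2)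
  sum-mixedWeight = cong (λ x → + 1 + x) (begin
    sum (λ (k : Fin (suc h ℕ.* 2)) → alternate (+ 0) (- (+ m - + 2)) (toℕ k))
      ≡⟨ sum-alternate (suc h) (- (+ m - + 2)) ⟩
    + suc h * - + suc (h ℕ.* 2)
      ≡⟨ ℤ.neg-distribʳ-* (+ suc h) (+ suc (h ℕ.* 2)) ⟨
    - (+ suc h * + suc (h ℕ.* 2))
      ≡⟨ cong -_ (ℤ.*-comm (+ suc h) (+ suc (h ℕ.* 2))) ⟩
    - (+ suc (h ℕ.* 2) * + suc h)
      ≡⟨ cong (λ n → - (+ n)) τ-value ⟨
    - (+ (((m ℕ.∸ 2) ℕ.* (m ℕ.∸ 1)) ℕ./ 2)) ∎)
    where open ≡-Reasoning

  sum-weight₁₁ : sum (λ (k : Fin m) → weight m 0F 0F (toℕ k)) ≡ + 0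
  sum-weight₁₁ = sum-replicate-zero m

  -- The `m - 2` entries r^o contribute 1 each and cancel the -(m - 2) of the single r^t s, so `Q²²`
  -- has the same unsigned exponent `2 μ̃` as `Q¹¹`.
  sum-weight₂₂ : sum (λ (k : Fin m) → weight m 1F 1F (toℕ k)) ≡ + 0
  sum-weight₂₂ = begin
    + 0 + (- + n + sum (λ (k : Fin n) → + 1))   ≡⟨ ℤ.+-identityˡ _ ⟩
    - + n + sum (λ (k : Fin n) → + 1)           ≡⟨ cong (λ x → - + n + x) (sum-ones n) ⟩
    - + n + + n                                 ≡⟨ ℤ.+-inverseˡ (+ n) ⟩
    + 0                                         ∎
    where
    open ≡-Reasoning
    n = suc (h ℕ.* 2)

  -- The sign closes up after one turn because the reflections met are even in number; in the mixed
  -- blocks there are `m - 1` of them.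
  phase-periodic : ∀ u v → phase u v m ≡ phase u v 0
  phase-periodic 0F 0F = refl
  phase-periodic 0F 1F = alternate-even {n = h ℕ.* 2} (n∣m*n h)
  phase-periodic 1F 0F = alternate-even {n = h ℕ.* 2} (n∣m*n h)
  phase-periodic 1F 1F = refl

-- Parity of cyclic distances

⊕-wrap : ∀ {m} (i : Fin m) {d} → d < m →
         toℕ (i ⊕ d) ≡ toℕ i ℕ.+ d ⊎ toℕ (i ⊕ d) ℕ.+ m ≡ toℕ i ℕ.+ d
⊕-wrap {m} i {d} d<m with toℕ i ℕ.+ d ℕ.<? m
... | yes i+d<m = inj₁ (trans (toℕ-⊕ i d) (m<n⇒m%n≡m i+d<m))
  where instance _ = ℕ.>-nonZero (ℕ.≤-<-trans z≤n d<m)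
... | no  i+d≮m = inj₂ (begin
    toℕ (i ⊕ d) ℕ.+ m                    ≡⟨ cong (ℕ._+ m) (toℕ-⊕ i d) ⟩
    (toℕ i ℕ.+ d) % m ℕ.+ m              ≡⟨ cong (ℕ._+ m) (m≤n⇒[n∸m]%m≡n%m m≤i+d) ⟨
    (toℕ i ℕ.+ d ℕ.∸ m) % m ℕ.+ m        ≡⟨ cong (ℕ._+ m) (m<n⇒m%n≡m i+d∸m<m) ⟩
    toℕ i ℕ.+ d ℕ.∸ m ℕ.+ m              ≡⟨ ℕ.m∸n+n≡m m≤i+d ⟩
    toℕ i ℕ.+ d                          ∎)
  where
  open ≡-Reasoning
  instance _ = ℕ.>-nonZero (ℕ.≤-<-trans z≤n d<m)
  m≤i+d : m ≤ toℕ i ℕ.+ d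
  m≤i+d = ℕ.≮⇒≥ i+d≮m
  i+d∸m<m : toℕ i ℕ.+ d ℕ.∸ m < m
  i+d∸m<m = subst (toℕ i ℕ.+ d ℕ.∸ m <_) (ℕ.m+n∸n≡m m m)
    (ℕ.∸-monoˡ-< (ℕ.+-mono-< (toℕ<n i) d<m) m≤i+d)

-- The condition decided by eCell?: for i ≠ j it says that j - i, reduced modulo m,
-- is odd.
OddDistance : ∀ {m} → Fin m → Fin m → Set
OddDistance i j = (Odd (toℕ i ℕ.+ toℕ j) × toℕ i < toℕ j) ⊎ (Even (toℕ i ℕ.+ toℕ j) × toℕ j < toℕ i)

private
  double+ : ∀ i d → i ℕ.+ (i ℕ.+ d) ≡ i ℕ.* 2 ℕ.+ d
  double+ = ℕ-Solver.solve-∀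

  even-double+ : ∀ i {d} → Even (i ℕ.+ (i ℕ.+ d)) → Even d
  even-double+ i even = ∣m+n∣m⇒∣n (subst (2 ∣_) (double+ i _) even) (n∣m*n i)

  double+-even : ∀ i {d} → Even d → Even (i ℕ.+ (i ℕ.+ d))
  double+-even i even = subst (2 ∣_) (sym (double+ i _)) (∣m∣n⇒∣m+n (n∣m*n i) even)

module _ {m : ℕ} (odd-m : Odd m) (i : Fin m) where

  private
    wrapped-sum : ∀ {j d} → j ℕ.+ m ≡ toℕ i ℕ.+ d → toℕ i ℕ.+ j ℕ.+ m ≡ toℕ i ℕ.+ (toℕ i ℕ.+ d)
    wrapped-sum {j} eq = trans (ℕ.+-assoc (toℕ i) j m) (cong (toℕ i ℕ.+_) eq)

    wrapped-< : ∀ {j d} → d < m → j ℕ.+ m ≡ toℕ i ℕ.+ d → j < toℕ i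
    wrapped-< {j} {d} d<m eq = ℕ.+-cancelʳ-< m j (toℕ i) (subst (_< toℕ i ℕ.+ m) (sym eq) (ℕ.+-monoʳ-< (toℕ i) d<m))

  -- Write j for `i ⊕ d`. Without wrapping, i + j = 2i + d and i < j. With wrapping, i + j + m = 2i
  -- + d and j < i, so the odd `m` reverses the parity just when the order is reversed. These are
  -- the two alternatives of `OddDistance`.
  odd-distance : ∀ {d} → d < m → Odd d → OddDistance i (i ⊕ d)
  odd-distance {zero}  d<m odd = contradiction (2 ∣0) odd
  odd-distance {suc d} d<m odd with ⊕-wrap i d<m
  ... | inj₁ eq = inj₁
    ( odd ∘ even-double+ (toℕ i) ∘ subst (λ j → Even (toℕ i ℕ.+ j)) eq
    , subst (toℕ i <_) (sym eq) (ℕ.m<m+n (toℕ i) (s≤s z≤n)) )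
  ... | inj₂ eq with 2 ∣? (toℕ i ℕ.+ toℕ (i ⊕ suc d))
  ...   | yes even = inj₂ (even , wrapped-< d<m eq)
  ...   | no  odd′ = contradiction
    (even-double+ (toℕ i) (subst (2 ∣_) (wrapped-sum eq) (odd+odd odd′ odd-m))) odd

  even-distance : ∀ {d} → d < m → Even d → ¬ OddDistance i (i ⊕ d)
  even-distance d<m even dist with ⊕-wrap i d<m | dist
  ... | inj₁ eq | inj₁ (odd , _) = odd (subst (λ j → Even (toℕ i ℕ.+ j)) (sym eq) (double+-even (toℕ i) even))
  ... | inj₁ eq | inj₂ (_ , j<i) = ℕ.<⇒≱ j<i (subst (toℕ i ≤_) (sym eq) (ℕ.m≤m+n (toℕ i) _))
  ... | inj₂ eq | inj₁ (_ , i<j) = ℕ.<-asym i<j (wrapped-< d<m eq)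
  ... | inj₂ eq | inj₂ (even′ , _) = odd-m
    (∣m+n∣m⇒∣n (subst (2 ∣_) (sym (wrapped-sum eq)) (double+-even (toℕ i) even)) even′)

-- The blocks of `Q` read by offset

module Entries {m : ℕ} (odd-m : Odd m) (1<m : 1 < m) (M : Array ℕ m) where
  open Construction M

  private
    instance m≢0 = ℕ.>-nonZero (ℕ.<-trans (s≤s z≤n) 1<m)
    0<m : 0 < m
    0<m = ℕ.<-trans (s≤s z≤n) 1<m

  ≟-⊕-yes : ∀ (i : Fin m) d → does (i ⊕ d Fin.≟ i ⊕ d) ≡ true
  ≟-⊕-yes i d = dec-true (i ⊕ d Fin.≟ i ⊕ d) refl

  ≟-⊕-no : ∀ (i : Fin m) {d d′} → d < m → d′ < m → d ≢ d′ → does (i ⊕ d Fin.≟ i ⊕ d′) ≡ false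
  ≟-⊕-no i {d} {d′} d<m d′<m d≢d′ = dec-false (i ⊕ d Fin.≟ i ⊕ d′) (d≢d′ ∘ ⊕-injectiveʳ i d<m d′<m)

  mixed-zero : ∀ i j′ → mixed i (i ⊕ 0) j′ ≡ value m O (M i j′)
  mixed-zero i j′ rewrite ⊕-identityʳ i | dec-true (i Fin.≟ i) refl = refl

  ⊕-≟-self : ∀ (i : Fin m) {d} → d < m → d ≢ 0 → does (i ⊕ d Fin.≟ i) ≡ false
  ⊕-≟-self i d<m d≢0 = subst (λ j → does (i ⊕ _ Fin.≟ j) ≡ false) (⊕-identityʳ i) (≟-⊕-no i d<m 0<m d≢0)

  odd≢0 : ∀ {d} → Odd d → d ≢ 0
  odd≢0 odd refl = odd (2 ∣0)

  mixed-odd : ∀ i j′ {d} → d < m → Odd d → mixed i (i ⊕ d) j′ ≡ value m S (M i j′)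
  mixed-odd i j′ {d} d<m odd
    rewrite ⊕-≟-self i d<m (odd≢0 odd)
          | dec-true (eCell? i (i ⊕ d)) (odd-distance odd-m i d<m odd) = refl

  mixed-even : ∀ i j′ {d} → suc d < m → Odd d → mixed i (i ⊕ suc d) j′ ≡ value m T (M i j′)
  mixed-even i j′ {d} d<m odd
    rewrite ⊕-≟-self i d<m (λ ())
          | dec-false (eCell? i (i ⊕ suc d)) (even-distance odd-m i d<m (even-suc odd)) = refl

  -- After this lemma the index tests defining the blocks are not unfolded again.
  cell-value : ∀ {u v d κ k} → Cell u v d κ k → d < m → ∀ i →
               block u v i (i ⊕ d) ≡ value m κ (M i (i ⊕ d ⊕ shift u v))
  cell-value e₀ _ i = cong (λ j → value m E (M i j)) (sym (⊕-identityʳ _))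
  cell-value o₀ _ i = trans (mixed-zero i _) (cong (λ j → value m O (M i j)) (sym (⊕-identityʳ _)))
  cell-value o₁ _ i = mixed-zero i _
  cell-value (s₁ odd) d<m i = trans (mixed-odd i _ d<m odd) (cong (λ j → value m S (M i j)) (sym (⊕-identityʳ _)))
  cell-value (s₂ odd) d<m i = mixed-odd i _ d<m odd
  cell-value (t₁ odd) d<m i = trans (mixed-even i _ d<m odd) (cong (λ j → value m T (M i j)) (sym (⊕-identityʳ _)))
  cell-value (t₂ odd) d<m i = mixed-even i _ d<m odd
  cell-value s₀ _ i rewrite ⊕-identityʳ (i ⊕ 0) | ⊕-identityʳ i | dec-true (i Fin.≟ i) refl = refl
  cell-value t₀ _ i rewrite ⊕-identityʳ (i ⊕ 1) | ⊕-≟-self i 1<m (λ ()) | ≟-⊕-yes i 1 = refl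
  cell-value (o₂ {d}) d<m i
    rewrite ⊕-identityʳ (i ⊕ suc (suc d)) | ⊕-≟-self i d<m (λ ()) | ≟-⊕-no i d<m 1<m (λ ()) = refl

-- Dihedral elements as kinds with values

2∤1 : ∀ a → + 2 * a ≢ + 1
2∤1 a eq with ∣1⇒≡1 (ℤ.∣⇒∣ᵤ {+ 2} {+ 1} (ℤ.divides a (trans (sym eq) (ℤ.*-comm (+ 2) a))))
... | ()

n<N∧N∣n⇒n≡0 : ∀ {n N} → n < N → N ∣ n → n ≡ 0
n<N∧N∣n⇒n≡0 {zero}  _   _   = refl
n<N∧N∣n⇒n≡0 {suc n} n<N N∣n = contradiction N∣n (>⇒∤ n<N)

private
  congruent⇒≤ : ∀ {N x y} q → x ≤ N → 1 ≤ y → + x - + y ≡ q * + N → x ≤ y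
  congruent⇒≤ {N} {x} {y} q x≤N 1≤y eq with ℕ.≤-total x y
  ... | inj₁ x≤y = x≤y
  ... | inj₂ y≤x = ℕ.m∸n≡0⇒m≤n (n<N∧N∣n⇒n≡0
    (ℕ.<-≤-trans (ℕ.∸-monoʳ-< {x} {y} {0} 1≤y y≤x) x≤N)
    (subst (λ z → N ∣ ∣ z ∣) (trans (ℤ.[+m]-[+n]≡m⊖n x y) (ℤ.⊖-≥ y≤x)) (ℤ.∣⇒∣ᵤ (ℤ.divides q eq))))

  negate-congruence : ∀ a b q n → a - b ≡ q * n → b - a ≡ - q * n
  negate-congruence a b q n eq = begin
    b - a        ≡⟨ lemma a b ⟩
    - (a - b)    ≡⟨ cong -_ eq ⟩
    - (q * n)    ≡⟨ ℤ.neg-distribˡ-* q n ⟩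
    - q * n      ∎
    where
    open ≡-Reasoning
    lemma : ∀ a b → b - a ≡ - (a - b)
    lemma = solve-∀

representative-unique : ∀ {N x y} q → 1 ≤ x × x ≤ N → 1 ≤ y × y ≤ N → + x - + y ≡ q * + N → x ≡ y
representative-unique {N} {x} {y} q (1≤x , x≤N) (1≤y , y≤N) eq = ℕ.≤-antisym
  (congruent⇒≤ q x≤N 1≤y eq)
  (congruent⇒≤ (- q) y≤N 1≤x (negate-congruence (+ x) (+ y) q (+ N) eq))

-- Magic square entries run from 1 to N, so `y` is lowered by 1 before the division and the
-- remainder raised by 1 after it.
representative : ∀ N .{{_ : NonZero N}} y → ∃₂ λ x q → (1 ≤ x × x ≤ N) × + x - y ≡ q * + N
representative N y = suc r , - p , (s≤s z≤n , n%ℕd<d (y - + 1) N) , (begin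
  + suc r - y                          ≡⟨ shift-one (+ r) y ⟩
  + r - (y - + 1)                      ≡⟨ cong (λ z → + r - z) (a≡a%ℕn+[a/ℕn]*n (y - + 1) N) ⟩
  + r - (+ r + p * + N)                ≡⟨ cancel (+ r) p (+ N) ⟩
  - p * + N                            ∎)
  where
  open ≡-Reasoning
  r = (y - + 1) %ℕ N
  p = (y - + 1) /ℕ N
  shift-one : ∀ r y → + 1 + r - y ≡ r - (y - + 1)
  shift-one = solve-∀
  cancel : ∀ r p n → r - (r + p * n) ≡ - p * n
  cancel = solve-∀

parity : ∀ z → ∃[ y ] (z ≡ + 2 * y ⊎ z ≡ + 2 * y + + 1)
parity z with z %ℕ 2 | n%ℕd<d z 2 | a≡a%ℕn+[a/ℕn]*n z 2
... | 0 | _ | eq = z /ℕ 2 , inj₁ (trans eq (lemma (z /ℕ 2)))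
  where
  lemma : ∀ y → + 0 + y * + 2 ≡ + 2 * y
  lemma = solve-∀
... | 1 | _ | eq = z /ℕ 2 , inj₂ (trans eq (lemma (z /ℕ 2)))
  where
  lemma : ∀ y → + 1 + y * + 2 ≡ + 2 * y + + 1
  lemma = solve-∀
... | suc (suc _) | s≤s (s≤s ()) | _

module Values (h : ℕ) (N : ℕ) where

  private
    m : ℕ
    m = 3 ℕ.+ h ℕ.* 2
    H : ℤ
    H = + h
    +m : + m ≡ + 3 + H * + 2
    +m = cong (λ x → + 3 + x) (ℤ.pos-* h 2)
    +2x : ∀ x → + (2 ℕ.* x) ≡ + 2 * + x
    +2x = ℤ.pos-* 2

  infix 4 _≋_
  _≋_ : Dih → Dih → Set
  _≋_ = _≈ᴰ_ (2 ℕ.* N)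

  private
    exponent-O : ∀ x → + (2 ℕ.* x ℕ.+ 1) ≡ + 2 * + x + + 1
    exponent-O x = cong (λ y → y + + 1) (+2x x)
    exponent-T : ∀ x → - (+ (2 ℕ.* x)) + + m - + 2 ≡ - (+ 2 * + x) + (+ 1 + H * + 2)
    exponent-T x = trans (cong₂ (λ a b → - a + b - + 2) (+2x x) +m) (lemma (+ 2 * + x) H)
      where
      lemma : ∀ a b → - a + (+ 3 + b * + 2) - + 2 ≡ - a + (+ 1 + b * + 2)
      lemma = solve-∀

    factor-2 : ∀ a b → + 2 * a - + 2 * b ≡ + 2 * (a - b)
    factor-2 = solve-∀
    factor-2+1 : ∀ a b → (+ 2 * a + + 1) - (+ 2 * b + + 1) ≡ + 2 * (a - b)
    factor-2+1 = solve-∀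

    halve : ∀ a q → + 2 * a ≡ q * + (2 ℕ.* N) → a ≡ q * + N
    halve a q eq = ℤ.*-cancelˡ-≡ (+ 2) a (q * + N) (trans eq (trans (cong (q *_) (+2x N)) (lemma q (+ N))))
      where
      lemma : ∀ q n → q * (+ 2 * n) ≡ + 2 * (q * n)
      lemma = solve-∀

    double : ∀ a q → a ≡ q * + N → + 2 * a ≡ q * + (2 ℕ.* N)
    double a q eq = trans (cong (λ z → + 2 * z) eq) (trans (lemma q (+ N)) (cong (q *_) (sym (+2x N))))
      where
      lemma : ∀ q n → + 2 * (q * n) ≡ q * (+ 2 * n)
      lemma = solve-∀

    odd-difference : ∀ a q → ¬ (+ 2 * a - + 1 ≡ q * + (2 ℕ.* N))
    odd-difference a q eq = 2∤1 (a - q * + N) (begin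
      + 2 * (a - q * + N)                                      ≡⟨ lemma a q (+ N) ⟩
      + 2 * a - + 1 - q * (+ 2 * + N) + + 1                    ≡⟨ cong (λ z → + 2 * a - + 1 - q * z + + 1) (+2x N) ⟨
      + 2 * a - + 1 - q * + (2 ℕ.* N) + + 1                    ≡⟨ cong (λ z → z - q * + (2 ℕ.* N) + + 1) eq ⟩
      q * + (2 ℕ.* N) - q * + (2 ℕ.* N) + + 1                  ≡⟨ cancel (q * + (2 ℕ.* N)) ⟩
      + 1                                                      ∎)
      where
      open ≡-Reasoning
      lemma : ∀ a q n → + 2 * (a - q * n) ≡ + 2 * a - + 1 - q * (+ 2 * n) + + 1
      lemma = solve-∀
      cancel : ∀ z → z - z + + 1 ≡ + 1
      cancel = solve-∀

  -- The modulus 2N is even, so parity of exponents is well defined. It separates e from o, and also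
  -- e from t, which is odd because `m` is odd. Within one kind the exponent can be halved, which
  -- leaves `x` modulo N.
  value-injective : ∀ κ κ′ {x y} → 1 ≤ x × x ≤ N → 1 ≤ y × y ≤ N →
                    value m κ x ≋ value m κ′ y → (κ , x) ≡ (κ′ , y)
  value-injective E E {x} {y} x∈ y∈ (rotation (congruent (ℤ.divides q eq))) =
    cong (E ,_) (representative-unique q x∈ y∈ (halve (+ x - + y) q (trans (sym (trans
      (cong₂ _-_ (+2x x) (+2x y)) (factor-2 (+ x) (+ y)))) eq)))
  value-injective O O {x} {y} x∈ y∈ (rotation (congruent (ℤ.divides q eq))) =
    cong (O ,_) (representative-unique q x∈ y∈ (halve (+ x - + y) q (trans (sym (trans
      (cong₂ _-_ (exponent-O x) (exponent-O y)) (factor-2+1 (+ x) (+ y)))) eq)))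
  value-injective S S {x} {y} x∈ y∈ (reflection (congruent (ℤ.divides q eq))) =
    cong (S ,_) (representative-unique q x∈ y∈ (halve (+ x - + y) q (trans (sym (trans
      (cong₂ _-_ (+2x x) (+2x y)) (factor-2 (+ x) (+ y)))) eq)))
  value-injective T T {x} {y} x∈ y∈ (reflection (congruent (ℤ.divides q eq))) =
    -- The exponent t decreases in `x`, so the difference is 2 (y - x) and the roles are exchanged.
    cong (T ,_) (sym (representative-unique q y∈ x∈ (halve (+ y - + x) q (trans (sym (trans
      (cong₂ _-_ (exponent-T x) (exponent-T y)) (lemma (+ x) (+ y) (+ 1 + H * + 2)))) eq))))
    where
    lemma : ∀ a b c → (- (+ 2 * a) + c) - (- (+ 2 * b) + c) ≡ + 2 * (b - a)
    lemma = solve-∀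
  value-injective E O {x} {y} _ _ (rotation (congruent (ℤ.divides q eq))) =
    contradiction (trans (sym (trans (cong₂ _-_ (+2x x) (exponent-O y)) (lemma (+ x) (+ y)))) eq)
      (odd-difference (+ x - + y) q)
    where
    lemma : ∀ a b → + 2 * a - (+ 2 * b + + 1) ≡ + 2 * (a - b) - + 1
    lemma = solve-∀
  value-injective O E {x} {y} _ _ (rotation (congruent (ℤ.divides q eq))) =
    contradiction (trans (sym (trans (cong₂ _-_ (exponent-O x) (+2x y)) (lemma (+ x) (+ y)))) eq)
      (odd-difference (+ x - + y + + 1) q)
    where
    lemma : ∀ a b → (+ 2 * a + + 1) - + 2 * b ≡ + 2 * (a - b + + 1) - + 1
    lemma = solve-∀
  value-injective S T {x} {y} _ _ (reflection (congruent (ℤ.divides q eq))) =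
    contradiction (trans (sym (trans (cong₂ _-_ (+2x x) (exponent-T y)) (lemma (+ x) (+ y) H))) eq)
      (odd-difference (+ x + + y - H) q)
    where
    lemma : ∀ a b c → + 2 * a - (- (+ 2 * b) + (+ 1 + c * + 2)) ≡ + 2 * (a + b - c) - + 1
    lemma = solve-∀
  value-injective T S {x} {y} _ _ (reflection (congruent (ℤ.divides q eq))) =
    contradiction (trans (sym (trans (cong₂ _-_ (exponent-T x) (+2x y)) (lemma (+ x) (+ y) H))) eq)
      (odd-difference (H + + 1 - + x - + y) q)
    where
    lemma : ∀ a b c → (- (+ 2 * a) + (+ 1 + c * + 2)) - + 2 * b ≡ + 2 * (c + + 1 - a - b) - + 1
    lemma = solve-∀
  value-injective E S _ _ ()
  value-injective E T _ _ ()
  value-injective O S _ _ ()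
  value-injective O T _ _ ()
  value-injective S E _ _ ()
  value-injective S O _ _ ()
  value-injective T E _ _ ()
  value-injective T O _ _ ()

  value-surjective : .{{_ : NonZero N}} → ∀ g → ∃₂ λ κ x → (1 ≤ x × x ≤ N) × value m κ x ≋ g
  value-surjective (r^ z) with parity z
  ... | y , inj₁ refl with representative N y
  ...   | x , q , x∈ , eq = E , x , x∈ , rotation (congruent (ℤ.divides q
    (trans (cong (λ a → a - + 2 * y) (+2x x)) (trans (factor-2 (+ x) y) (double (+ x - y) q eq)))))
  value-surjective (r^ z) | y , inj₂ refl with representative N y
  ...   | x , q , x∈ , eq = O , x , x∈ , rotation (congruent (ℤ.divides q
    (trans (cong (λ a → a - (+ 2 * y + + 1)) (exponent-O x)) (trans (factor-2+1 (+ x) y) (double (+ x - y) q eq)))))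
  value-surjective (r^ z ·s) with parity z
  ... | y , inj₁ refl with representative N y
  ...   | x , q , x∈ , eq = S , x , x∈ , reflection (congruent (ℤ.divides q
    (trans (cong (λ a → a - + 2 * y) (+2x x)) (trans (factor-2 (+ x) y) (double (+ x - y) q eq)))))
  -- Since m - 2 = 1 + 2h, the equation -2x + 1 + 2h = 2y + 1 is solved by x = h - y.
  value-surjective (r^ z ·s) | y , inj₂ refl with representative N (H - y)
  ...   | x , q , x∈ , eq = T , x , x∈ , reflection (congruent (ℤ.divides (- q)
    (trans (cong (λ a → a - (+ 2 * y + + 1)) (exponent-T x)) (trans (lemma (+ x) y H)
      (double ((H - y) - + x) (- q) (negate-congruence (+ x) (H - y) q (+ N) eq))))))
    where
    lemma : ∀ a b c → (- (+ 2 * a) + (+ 1 + c * + 2)) - (+ 2 * b + + 1) ≡ + 2 * ((c - b) - a)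
    lemma = solve-∀

-- Splitting lists and indices into halves

product-++ : ∀ (Γ : Group a ℓ) (xs ys : List (Group.Carrier Γ)) →
             Group._≈_ Γ (product Γ (xs List.++ ys)) (Group._∙_ Γ (product Γ xs) (product Γ ys))
product-++ Γ List.[]       ys = Group.sym Γ (Group.identityˡ Γ _)
product-++ Γ (x List.∷ xs) ys = Group.trans Γ (Group.∙-congˡ Γ (product-++ Γ xs ys)) (Group.sym Γ (Group.assoc Γ x _ _))

toList-↑ : ∀ {A : Set a} m {n} (f : Vector A (m ℕ.+ n)) →
           toList f ≡ toList (λ i → f (i ↑ˡ n)) List.++ toList (λ j → f (m ↑ʳ j))
toList-↑ zero    f = refl
toList-↑ (suc m) f = cong (f 0F List.∷_) (toList-↑ m (f ∘ Fin.suc))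

halfIndex : ∀ {m} → Fin 2 → Fin m → Fin (m ℕ.+ m)
halfIndex {m} 0F i = i ↑ˡ m
halfIndex {m} 1F i = m ↑ʳ i

halfIndex-surjective : ∀ {m} (I : Fin (m ℕ.+ m)) → ∃₂ λ u i → halfIndex {m} u i ≡ I
halfIndex-surjective {m} I with Fin.splitAt m I in eq
... | inj₁ i = 0F , i , splitAt⁻¹-↑ˡ eq
... | inj₂ i = 1F , i , splitAt⁻¹-↑ʳ {m} eq

-- Row and column products and the semi-magic property

module Products (h : ℕ) {m : ℕ} (m≡ : m ≡ 3 ℕ.+ h ℕ.* 2) (odd-m : Odd m) (M : Array ℕ m) (isMagic : IsMagicSquare M) where
  open Construction M
  open IsMagicSquare isMagic
  open Group D using (reflexive)

  private
    1<m : 1 < m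
    1<m = subst (1 <_) (sym m≡) (s≤s (s≤s z≤n))
    instance m≢0 = ℕ.>-nonZero (ℕ.<-trans (s≤s z≤n) 1<m)

  open Entries odd-m 1<m M

  -- The two arguments differ only when `n % m` is the last offset, and there `phase-periodic`
  -- identifies the signs.
  phase-suc-% : ∀ u v n → phase u v (suc (n % m)) ≡ phase u v (suc n % m)
  phase-suc-% u v n = trans wrap (cong (phase u v) suc-%)
    where
    open ≡-Reasoning
    suc-% : suc (n % m) % m ≡ suc n % m
    suc-% = begin
      (1 ℕ.+ n % m) % m            ≡⟨ %-distribˡ-+ 1 (n % m) m ⟩
      (1 % m ℕ.+ n % m % m) % m    ≡⟨ cong (λ x → (1 % m ℕ.+ x) % m) (m%n%n≡m%n n m) ⟩
      (1 % m ℕ.+ n % m) % m        ≡⟨ %-distribˡ-+ 1 n m ⟨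
      suc n % m                    ∎
    periodic : phase u v m ≡ phase u v 0
    periodic = subst (λ m → phase u v m ≡ phase u v 0) (sym m≡) (phase-periodic h u v)
    wrap : phase u v (suc (n % m)) ≡ phase u v (suc (n % m) % m)
    wrap with ℕ.m≤n⇒m<n∨m≡n (m%n<n n m)
    ... | inj₁ 1+d<m = cong (phase u v) (sym (m<n⇒m%n≡m 1+d<m))
    ... | inj₂ 1+d≡m = begin
      phase u v (suc (n % m))      ≡⟨ cong (phase u v) 1+d≡m ⟩
      phase u v m                  ≡⟨ periodic ⟩
      phase u v 0                  ≡⟨ cong (phase u v) (n%n≡0 m) ⟨
      phase u v (m % m)            ≡⟨ cong (λ d → phase u v (d % m)) 1+d≡m ⟨
      phase u v (suc (n % m) % m)  ∎

  entry-step : ∀ u v i n → block u v i (i ⊕ n) ≡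
    step (phase u v (n % m)) (phase u v (suc n % m)) (+ 2 * + M i (i ⊕ n ⊕ shift u v) + weight m u v (n % m))
  entry-step u v i n with cell u v (n % m)
  ... | κ , k , C = begin
    block u v i (i ⊕ n)
      ≡⟨ cong (block u v i) (⊕-% i n) ⟨
    block u v i (i ⊕ n % m)
      ≡⟨ cell-value C (m%n<n n m) i ⟩
    value m κ (M i (i ⊕ n % m ⊕ shift u v))
      ≡⟨ cong (λ j → value m κ (M i (j ⊕ shift u v))) (⊕-% i n) ⟩
    value m κ (M i (i ⊕ n ⊕ shift u v))
      ≡⟨ value-step m _ C ⟩
    step (phase u v (n % m)) (phase u v (suc (n % m))) x
      ≡⟨ cong (λ q → step (phase u v (n % m)) q x) (phase-suc-% u v n) ⟩
    step (phase u v (n % m)) (phase u v (suc n % m)) x ∎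
    where
    open ≡-Reasoning
    x = + 2 * + M i (i ⊕ n ⊕ shift u v) + weight m u v (n % m)

  totalWeight : Fin 2 → Fin 2 → ℤ
  totalWeight u v = sum (λ (k : Fin m) → weight m u v (toℕ k))

  private
    ΣMagic : ∀ (f g : Vector ℕ m) (π : Permutation′ m) → (∀ k → g k ≡ f (π ⟨$⟩ʳ k)) →
             ℕ-Sum.sum f ≡ magicConstant m →
             ℕ-Sum.sum g ≡ magicConstant m
    ΣMagic f g π g≗fπ Σf = trans (ℕ-Sum.sum-cong-≗ g≗fπ)
      (trans (sym (ℕ-Sum.sum-permute f π)) Σf)

  ρ-value : ∀ u v i {c} → c < m → ρ u v i c ≡ step (phase u v c) (phase u v c) (+ 2 * μ̃ + totalWeight u v)
  ρ-value u v i {c} c<m = subst (λ d → ρ u v i c ≡ step (phase u v d) (phase u v d) (+ 2 * μ̃ + totalWeight u v))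
    (m<n⇒m%n≡m c<m)
    (cyclic-product {m} {2 ℕ.* (m ℕ.* m)} (phase u v) (weight m u v) (λ n → M i (i ⊕ n ⊕ shift u v)) (λ n → block u v i (i ⊕ n))
      (entry-step u v i) c
      -- The column shift of `Q²¹` only moves the starting point, so row `i` of `M` is still read in
      -- full.
      (ΣMagic (M i) _ (rotation-permutation i (c ℕ.+ shift u v))
        (λ k → cong (M i) (trans (⊕-assoc i _ (shift u v)) (cong (i ⊕_) (commute c (toℕ k) (shift u v)))))
        (row i)))
    where
    commute : ∀ a b c → a ℕ.+ b ℕ.+ c ≡ a ℕ.+ c ℕ.+ b
    commute a b c = trans (ℕ.+-assoc a b c) (trans (cong (a ℕ.+_) (ℕ.+-comm b c)) (sym (ℕ.+-assoc a c b)))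

  -- Moving up by n rows raises the offset by n, so signs and weights are those of a row. The
  -- exponents all come from one column of `M`, which for `Q²¹` is the next one.
  σ-value : ∀ u v j {c} → c < m → σ u v j c ≡ step (phase u v c) (phase u v c) (+ 2 * μ̃ + totalWeight u v)
  σ-value u v j {c} c<m = subst (λ d → σ u v j c ≡ step (phase u v d) (phase u v d) (+ 2 * μ̃ + totalWeight u v))
    (m<n⇒m%n≡m c<m)
    (cyclic-product {m} {2 ℕ.* (m ℕ.* m)} (phase u v) (weight m u v) (λ n → M (j ⊖ n) (j ⊕ shift u v)) (λ n → block u v (j ⊖ n) j)
      column-step c
      (ΣMagic (λ i → M i (j ⊕ shift u v)) _ (reflection-permutation j c) (λ k → refl) (column (j ⊕ shift u v))))
    where
    column-step : ∀ n → block u v (j ⊖ n) j ≡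
      step (phase u v (n % m)) (phase u v (suc n % m)) (+ 2 * + M (j ⊖ n) (j ⊕ shift u v) + weight m u v (n % m))
    column-step n = subst (λ j′ → block u v (j ⊖ n) j′ ≡
      step (phase u v (n % m)) (phase u v (suc n % m)) (+ 2 * + M (j ⊖ n) (j′ ⊕ shift u v) + weight m u v (n % m)))
      (⊖-⊕ j n) (entry-step u v (j ⊖ n) n)

  Q-block : ∀ u v i j → Q (halfIndex u i) (halfIndex v j) ≡ block u v i j
  Q-block 0F 0F i j rewrite splitAt-↑ˡ m i m | splitAt-↑ˡ m j m = refl
  Q-block 0F 1F i j rewrite splitAt-↑ˡ m i m | splitAt-↑ʳ m m j = refl
  Q-block 1F 0F i j rewrite splitAt-↑ʳ m m i | splitAt-↑ˡ m j m = refl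
  Q-block 1F 1F i j rewrite splitAt-↑ʳ m m i | splitAt-↑ʳ m m j = refl

  private
    ↭-halves : ∀ (f : Vector Dih (m ℕ.+ m)) (g₁ g₂ : Vector Dih m) (π₁ π₂ : Permutation′ m) →
               (∀ k → f (halfIndex 0F k) ≡ g₁ k) → (∀ k → f (halfIndex 1F k) ≡ g₂ k) →
               toList (λ k → g₁ (π₁ ⟨$⟩ʳ k)) List.++ toList (λ k → g₂ (π₂ ⟨$⟩ʳ k)) ↭ toList f
    ↭-halves f g₁ g₂ π₁ π₂ f≗g₁ f≗g₂ = ↭-trans
      (++⁺ (toList-permute g₁ π₁) (toList-permute g₂ π₂))
      (↭-reflexive (sym (trans (toList-↑ m f) (cong₂ List._++_ (List.tabulate-cong f≗g₁) (List.tabulate-cong f≗g₂)))))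

  Q-row : ∀ u i c d {μ} → ρ u 0F i c ∙ ρ u 1F i d ≈ μ →
          ∃[ xs ] xs ↭ toList (λ J → Q (halfIndex u i) J) × product D xs ≈ μ
  Q-row u i c d eq = half 0F c List.++ half 1F d
    , ↭-halves (Q (halfIndex u i)) (block u 0F i) (block u 1F i) (rotation-permutation i c) (rotation-permutation i d)
        (Q-block u 0F i) (Q-block u 1F i)
    , Group.trans D (product-++ D (half 0F c) (half 1F d)) eq
    where
    half : Fin 2 → ℕ → List Dih
    half v c = toList (λ (k : Fin m) → block u v i (i ⊕ (c ℕ.+ toℕ k)))

  Q-column : ∀ v j c d {μ} → σ 0F v j c ∙ σ 1F v j d ≈ μ →
             ∃[ xs ] xs ↭ toList (λ I → Q I (halfIndex v j)) × product D xs ≈ μ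
  Q-column v j c d eq = half 0F c List.++ half 1F d
    , ↭-halves (λ I → Q I (halfIndex v j)) (λ i → block 0F v i j) (λ i → block 1F v i j)
        (reflection-permutation j c) (reflection-permutation j d)
        (λ i → Q-block 0F v i j) (λ i → Q-block 1F v i j)
    , Group.trans D (product-++ D (half 0F c) (half 1F d)) eq
    where
    half : Fin 2 → ℕ → List Dih
    half u c = toList (λ (k : Fin m) → block u v (j ⊖ (c ℕ.+ toℕ k)) j)

  private
    slot-column : ∀ {u v d κ k} → Cell u v d κ k → ∀ (i : Fin m) → i ⊕ d ⊕ shift u v ≡ i ⊕ base κ ⊕ k
    slot-column {u} {v} {d} {κ} {k} C i = begin
      i ⊕ d ⊕ shift u v        ≡⟨ ⊕-assoc i d (shift u v) ⟩
      i ⊕ (d ℕ.+ shift u v)    ≡⟨ cong (i ⊕_) (trans (ℕ.+-comm d (shift u v)) (sym (base-slot C))) ⟩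
      i ⊕ (base κ ℕ.+ k)       ≡⟨ ⊕-assoc i (base κ) k ⟨
      i ⊕ base κ ⊕ k           ∎
      where open ≡-Reasoning

    Q-cell : ∀ {u v d κ k} → Cell u v d κ k → d < m → ∀ i →
             Q (halfIndex u i) (halfIndex v (i ⊕ d)) ≡ value m κ (M i (i ⊕ base κ ⊕ k))
    Q-cell {u} {v} {d} {κ} C d<m i = trans (Q-block u v i (i ⊕ d))
      (trans (cell-value C d<m i) (cong (λ j → value m κ (M i j)) (slot-column C i)))

    same-slot : ∀ i {u v d u′ v′ d′ κ k k′} → Cell u v d κ k → Cell u′ v′ d′ κ k′ → k < m → k′ < m →
                i ⊕ base κ ⊕ k ≡ i ⊕ base κ ⊕ k′ →
                (halfIndex {m} u i , halfIndex v (i ⊕ d)) ≡ (halfIndex u′ i , halfIndex v′ (i ⊕ d′))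
    same-slot i {κ = κ} C C′ k<m k′<m eq with ⊕-injectiveʳ (i ⊕ base κ) k<m k′<m eq
    ... | refl with cell-unique C C′
    ...   | refl = refl

    value-injective-m : ∀ κ κ′ {x y} → 1 ≤ x × x ≤ m ℕ.* m → 1 ≤ y × y ≤ m ℕ.* m →
                        value m κ x ≈ value m κ′ y → (κ , x) ≡ (κ′ , y)
    value-injective-m = subst (λ n → ∀ κ κ′ {x y} → 1 ≤ x × x ≤ m ℕ.* m → 1 ≤ y × y ≤ m ℕ.* m →
                        value n κ x ≈ value n κ′ y → (κ , x) ≡ (κ′ , y)) (sym m≡) (Values.value-injective h (m ℕ.* m))

    value-surjective-m : ∀ g → ∃₂ λ κ x → (1 ≤ x × x ≤ m ℕ.* m) × value m κ x ≈ g
    value-surjective-m = subst (λ n → ∀ g → ∃₂ λ κ x → (1 ≤ x × x ≤ m ℕ.* m) × value n κ x ≈ g) (sym m≡)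
      (Values.value-surjective h (m ℕ.* m) {{ℕ.m*n≢0 m m}})

  -- A chain of bijections: `g` fixes a kind and a value, the value fixes a cell of `M` in some row
  -- `i`, its column fixes the slot relative to `i ⊕ base κ`, and kind with slot fix block and
  -- offset. Uniqueness retraces the chain.
  Q-exactly-once : ∀ g → ∃! _≡_ (λ cell → uncurry Q cell ≈ g)
  Q-exactly-once g with value-surjective-m g
  ... | κ , x , (1≤x , x≤m²) , κx≈g with exactly-once x 1≤x x≤m²
  ...   | (i , j) , Mij≡x , unique with cell-at odd-m 1<m κ (offset (i ⊕ base κ) j) (offset<m (i ⊕ base κ) j)
  ...     | u , v , d , d<m , C = (halfIndex u i , halfIndex v (i ⊕ d)) , here , λ {cell} → only {cell}
    where
    here : Q (halfIndex u i) (halfIndex v (i ⊕ d)) ≈ g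
    here = Group.trans D (reflexive (trans (Q-cell C d<m i)
      (cong (value m κ) (trans (cong (M i) (⊕-offset (i ⊕ base κ) j)) Mij≡x)))) κx≈g

    only′ : ∀ {u′ v′ d′ κ′ k′} i′ → d′ < m → Cell u′ v′ d′ κ′ k′ →
            value m κ′ (M i′ (i′ ⊕ base κ′ ⊕ k′)) ≈ g →
            (halfIndex u i , halfIndex v (i ⊕ d)) ≡ (halfIndex u′ i′ , halfIndex v′ (i′ ⊕ d′))
    only′ {κ′ = κ′} {k′} i′ d′<m C′ eq
      with value-injective-m κ κ′ (1≤x , x≤m²) (entry-range i′ (i′ ⊕ base κ′ ⊕ k′)) (Group.trans D κx≈g (Group.sym D eq))
    ... | refl with unique {i′ , i′ ⊕ base κ ⊕ k′} refl
    ...   | refl = same-slot i C C′ (offset<m (i ⊕ base κ) j) (slot<m odd-m 1<m C′ d′<m) (⊕-offset (i ⊕ base κ) j)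

    only : ∀ {cell} → uncurry Q cell ≈ g → (halfIndex u i , halfIndex v (i ⊕ d)) ≡ cell
    only {I , J} eq with halfIndex-surjective {m} I | halfIndex-surjective {m} J
    ... | u′ , i′ , refl | v′ , j′ , refl with cell u′ v′ (offset i′ j′)
    ...   | κ′ , k′ , C′ = trans
      (only′ i′ (offset<m i′ j′) C′ (Group.trans D (Group.sym D (reflexive (trans
        (cong (λ j → Q (halfIndex u′ i′) (halfIndex v′ j)) (sym (⊕-offset i′ j′)))
        (Q-cell C′ (offset<m i′ j′) i′)))) eq))
      (cong (λ j → halfIndex u′ i′ , halfIndex v′ j) (⊕-offset i′ j′))

  sum-weight-mixed : sum (λ (k : Fin m) → mixedWeight m (toℕ k)) ≡ + 1 - τ
  sum-weight-mixed = subst (λ m → sum (λ (k : Fin m) → mixedWeight m (toℕ k))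
    ≡ + 1 - + (((m ℕ.∸ 2) ℕ.* (m ℕ.∸ 1)) ℕ./ 2)) (sym m≡) (sum-mixedWeight h)

  diagonal-weight : ∀ u → totalWeight u u ≡ + 0
  diagonal-weight 0F = subst (λ m → sum (λ (k : Fin m) → weight m 0F 0F (toℕ k)) ≡ + 0)
    (sym m≡) (sum-weight₁₁ h)
  diagonal-weight 1F = subst (λ m → sum (λ (k : Fin m) → weight m 1F 1F (toℕ k)) ≡ + 0)
    (sym m≡) (sum-weight₂₂ h)

  x₊ x₋ μ₁ μ₂ : Dih
  x₊ = r^ (+ 2 * μ̃ - τ + + 1)
  x₋ = r^ (- (+ 2 * μ̃) + τ - + 1)
  μ₁ = r^ (+ 4 * μ̃ - τ + + 1)
  μ₂ = r^ (τ - + 1)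

  infix 4 _ByCases_
  -- `ByCase` with `≡` for `≈`: the exponents agree already as integers, and `cong` then carries
  -- them through products.
  _ByCases_ : ℕ → Dih → Set
  c ByCases g = (Odd c ⊎ c ≡ 0 → g ≡ x₊) × (Even c × c ≢ 0 → g ≡ x₋)

  byCase : ∀ {c g} → c ByCases g → ByCase c g x₊ x₋
  byCase (odd , even) = reflexive ∘ odd , reflexive ∘ even

  private
    mixed-step : ∀ {c g} → g ≡ step (mixedPhase c) (mixedPhase c) (+ 2 * μ̃ + totalWeight 0F 1F) →
                 c ByCases g
    mixed-step eq =
      (λ p → trans eq (trans (cong₂ (λ s w → step s s (+ 2 * μ̃ + w)) (mixedPhase-odd p) sum-weight-mixed)
        (cong r^_ (plus (+ 2 * μ̃) τ)))) ,
      (λ p → trans eq (trans (cong₂ (λ s w → step s s (+ 2 * μ̃ + w)) (mixedPhase-even p) sum-weight-mixed)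
        (cong r^_ (minus (+ 2 * μ̃) τ))))
      where
      plus : ∀ a b → a + (+ 1 - b) ≡ a - b + + 1
      plus = solve-∀
      minus : ∀ a b → - (a + (+ 1 - b)) ≡ - a + b - + 1
      minus = solve-∀

  mixed-product : ∀ {u v} → Odd (toℕ u ℕ.+ toℕ v) → ∀ {c g} →
                  g ≡ step (phase u v c) (phase u v c) (+ 2 * μ̃ + totalWeight u v) →
                  c ByCases g
  mixed-product {0F} {0F} odd eq = contradiction (2 ∣0) odd
  mixed-product {1F} {1F} odd eq = contradiction (divides 1 refl) odd
  mixed-product {0F} {1F} _   eq = mixed-step eq
  mixed-product {1F} {0F} _   eq = mixed-step eq

  diagonal-product : ∀ u {c g} → phase u u c ≡ Sign.+ →
                     g ≡ step (phase u u c) (phase u u c) (+ 2 * μ̃ + totalWeight u u) → g ≡ r^ (+ 2 * μ̃)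
  diagonal-product u phase≡+ eq = trans eq (trans
    (cong₂ (λ s w → step s s (+ 2 * μ̃ + w)) phase≡+ (diagonal-weight u)) (cong r^_ (ℤ.+-identityʳ _)))

  private
    2μ̃+x₊ : ∀ a b → + 2 * a + (+ 2 * a - b + + 1) ≡ + 4 * a - b + + 1
    2μ̃+x₊ = solve-∀
    x₊+2μ̃ : ∀ a b → (+ 2 * a - b + + 1) + + 2 * a ≡ + 4 * a - b + + 1
    x₊+2μ̃ = solve-∀
    2μ̃+x₋ : ∀ a b → + 2 * a + (- (+ 2 * a) + b - + 1) ≡ b - + 1
    2μ̃+x₋ = solve-∀
    x₋+2μ̃ : ∀ a b → (- (+ 2 * a) + b - + 1) + + 2 * a ≡ b - + 1
    x₋+2μ̃ = solve-∀

  -- Both factors are rotations, so the `2 μ̃` of the diagonal block either doubles or cancels that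
  -- of the mixed one.
  diagonal-mixed : ∀ {c g g′} → g ≡ r^ (+ 2 * μ̃) → c ByCases g′ → ByCase c (g ∙ g′) μ₁ μ₂
  diagonal-mixed refl (odd , even) =
    (λ p → reflexive (trans (cong (r^ (+ 2 * μ̃) ∙_) (odd p)) (cong r^_ (2μ̃+x₊ μ̃ τ)))) ,
    (λ p → reflexive (trans (cong (r^ (+ 2 * μ̃) ∙_) (even p)) (cong r^_ (2μ̃+x₋ μ̃ τ))))

  mixed-diagonal : ∀ {c g g′} → c ByCases g → g′ ≡ r^ (+ 2 * μ̃) → ByCase c (g ∙ g′) μ₁ μ₂
  mixed-diagonal (odd , even) refl =
    (λ p → reflexive (trans (cong (_∙ r^ (+ 2 * μ̃)) (odd p)) (cong r^_ (x₊+2μ̃ μ̃ τ)))) ,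
    (λ p → reflexive (trans (cong (_∙ r^ (+ 2 * μ̃)) (even p)) (cong r^_ (x₋+2μ̃ μ̃ τ))))

  phase-diagonal : ∀ {c} → c ≢ 1 → phase 1F 1F c ≡ Sign.+
  phase-diagonal {0}           _   = refl
  phase-diagonal {1}           c≢1 = contradiction refl c≢1
  phase-diagonal {suc (suc _)} _   = refl

  private
    0<m : 0 < m
    0<m = ℕ.<-trans (ℕ.n<1+n 0) 1<m
    2<m : 2 < m
    2<m = subst (2 <_) (sym m≡) (s≤s (s≤s (s≤s z≤n)))
    1-odd : Odd 1
    1-odd = odd-suc (2 ∣0)

  ρ-mixed : ∀ u v → Odd (toℕ u ℕ.+ toℕ v) → ∀ i c → c < m → c ByCases ρ u v i c
  ρ-mixed u v odd i c c<m = mixed-product {u} {v} odd (ρ-value u v i c<m)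

  σ-mixed : ∀ u v → Odd (toℕ u ℕ.+ toℕ v) → ∀ j c → c < m → c ByCases σ u v j c
  σ-mixed u v odd j c c<m = mixed-product {u} {v} odd (σ-value u v j c<m)

  ρ-diagonal : ∀ u i {c} → c < m → phase u u c ≡ Sign.+ → ρ u u i c ≡ r^ (+ 2 * μ̃)
  ρ-diagonal u i c<m phase≡+ = diagonal-product u phase≡+ (ρ-value u u i c<m)

  σ-diagonal : ∀ u j {c} → c < m → phase u u c ≡ Sign.+ → σ u u j c ≡ r^ (+ 2 * μ̃)
  σ-diagonal u j c<m phase≡+ = diagonal-product u phase≡+ (σ-value u u j c<m)

  ρ₁ : ∀ i c → c < m → ByCase c (ρ 0F 0F i 0 ∙ ρ 0F 1F i c) μ₁ μ₂
  ρ₁ i c c<m = diagonal-mixed (ρ-diagonal 0F i 0<m refl) (ρ-mixed 0F 1F 1-odd i c c<m)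

  ρ₂ : ∀ i c → c < m → ByCase c (ρ 1F 0F i c ∙ ρ 1F 1F i 0) μ₁ μ₂
  ρ₂ i c c<m = mixed-diagonal (ρ-mixed 1F 0F 1-odd i c c<m) (ρ-diagonal 1F i 0<m refl)

  -- At `c ≡ 1` the reading of `Q²²` would begin between its two reflections and its exponent would
  -- change sign.
  ρ₂′ : ∀ i c → c < m → c ≢ 1 → ρ 1F 0F i 0 ∙ ρ 1F 1F i c ≈ μ₁
  ρ₂′ i c c<m c≢1 = proj₁ (mixed-diagonal (ρ-mixed 1F 0F 1-odd i 0 0<m)
    (ρ-diagonal 1F i c<m (phase-diagonal c≢1))) (inj₂ refl)

  σ₁ : ∀ j c → c < m → ByCase c (σ 0F 0F j 0 ∙ σ 1F 0F j c) μ₁ μ₂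
  σ₁ j c c<m = diagonal-mixed (σ-diagonal 0F j 0<m refl) (σ-mixed 1F 0F 1-odd j c c<m)

  σ₂ : ∀ j c → c < m → ByCase c (σ 0F 1F j c ∙ σ 1F 1F j 0) μ₁ μ₂
  σ₂ j c c<m = mixed-diagonal (σ-mixed 0F 1F 1-odd j c c<m) (σ-diagonal 1F j 0<m refl)

  σ₂′ : ∀ j c → c < m → c ≢ 1 → σ 0F 1F j 0 ∙ σ 1F 1F j c ≈ μ₁
  σ₂′ j c c<m c≢1 = proj₁ (mixed-diagonal (σ-mixed 0F 1F 1-odd j 0 0<m)
    (σ-diagonal 1F j c<m (phase-diagonal c≢1))) (inj₂ refl)

  semiMagic : ∀ c {μ} →
              (∀ i → ρ 0F 0F i 0 ∙ ρ 0F 1F i c ≈ μ) → (∀ i → ρ 1F 0F i c ∙ ρ 1F 1F i 0 ≈ μ) →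
              (∀ j → σ 0F 0F j 0 ∙ σ 1F 0F j c ≈ μ) → (∀ j → σ 0F 1F j c ∙ σ 1F 1F j 0 ≈ μ) →
              IsSemiMagicSquare D Q μ
  semiMagic c {μ} row₁ row₂ column₁ column₂ = record
    { exactly-once = Q-exactly-once ; row = rows ; column = columns }
    where
    rows : ∀ I → ∃[ xs ] xs ↭ toList (λ J → Q I J) × product D xs ≈ μ
    rows I with halfIndex-surjective {m} I
    ... | 0F , i , refl = Q-row 0F i 0 c (row₁ i)
    ... | 1F , i , refl = Q-row 1F i c 0 (row₂ i)
    columns : ∀ J → ∃[ xs ] xs ↭ toList (λ I → Q I J) × product D xs ≈ μ
    columns J with halfIndex-surjective {m} J
    ... | 0F , j , refl = Q-column 0F j 0 c (column₁ j)
    ... | 1F , j , refl = Q-column 1F j c 0 (column₂ j)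

  semiMagic-μ₁ : IsSemiMagicSquare D Q μ₁
  -- Starting every block on its diagonal gives sign + throughout.
  semiMagic-μ₁ = semiMagic 0
    (λ i → proj₁ (ρ₁ i 0 0<m) (inj₂ refl)) (λ i → proj₁ (ρ₂ i 0 0<m) (inj₂ refl))
    (λ j → proj₁ (σ₁ j 0 0<m) (inj₂ refl)) (λ j → proj₁ (σ₂ j 0 0<m) (inj₂ refl))

  semiMagic-μ₂ : IsSemiMagicSquare D Q μ₂
  -- The least non-zero even start, available since m ≥ 3.
  semiMagic-μ₂ = semiMagic 2
    (λ i → proj₂ (ρ₁ i 2 2<m) 2-even) (λ i → proj₂ (ρ₂ i 2 2<m) 2-even)
    (λ j → proj₂ (σ₁ j 2 2<m) 2-even) (λ j → proj₂ (σ₂ j 2 2<m) 2-even)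
    where
    2-even : Even 2 × 2 ≢ 0
    2-even = divides 1 refl , λ ()

-- When the two constants agree

-- 4 μ̃ - 2 τ + 2 = 2 m³ - m² + 5 m, which 2 m² can only divide if m ∣ 5.
congruent-constants⇒m∣5 : ∀ h → let m = 3 ℕ.+ h ℕ.* 2
                                    μ̃ = + magicConstant m
                                    τ = + (((m ℕ.∸ 2) ℕ.* (m ℕ.∸ 1)) ℕ./ 2) in
                          ∀ q → (+ 4 * μ̃ - τ + + 1) - (τ - + 1) ≡ q * + (2 ℕ.* (m ℕ.* m)) → m ∣ 5
congruent-constants⇒m∣5 h q eq = ℤ.∣⇒∣ᵤ {+ m} {+ 5} (ℤ.divides k (ℤ.*-cancelˡ-≡ (+ m) (+ 5) (k * + m) (begin
  + m * + 5                              ≡⟨ cong (_* + 5) +m ⟩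
  P * + 5                                ≡⟨ lemma H q ⟩
  (+ 4 * (P * A) - B + + 1) - (B - + 1) - q * (+ 2 * (P * P)) + P * (k * P)
    ≡⟨ cong (λ z → z - q * (+ 2 * (P * P)) + P * (k * P)) polynomial ⟩
  q * (+ 2 * (P * P)) - q * (+ 2 * (P * P)) + P * (k * P)
    ≡⟨ cancel (q * (+ 2 * (P * P))) (P * (k * P)) ⟩
  P * (k * P)                            ≡⟨ cong (λ z → z * (k * z)) +m ⟨
  + m * (k * + m)                        ∎)))
  where
  open ≡-Reasoning
  m = 3 ℕ.+ h ℕ.* 2
  H P A B k : ℤ
  H = + h
  P = + 3 + H * + 2
  A = + 5 + H * + 6 + H * H * + 2
  B = (+ 1 + H * + 2) * (+ 1 + H)
  -- Obtained by dividing 2m³ - m² + 5m = 2qm² by m and solving for 5.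
  k = + 2 * q - + 2 * P + + 1
  +m : + m ≡ P
  +m = cong (λ x → + 3 + x) (ℤ.pos-* h 2)
  +μ̃ : + magicConstant m ≡ P * A
  +μ̃ = trans (cong +_ (magicConstant-value h)) (trans (ℤ.pos-* m (5 ℕ.+ h ℕ.* 6 ℕ.+ h ℕ.* h ℕ.* 2)) (cong₂ _*_ +m
    (cong₂ (λ a b → + 5 + a + b) (ℤ.pos-* h 6) (trans (ℤ.pos-* (h ℕ.* h) 2) (cong (_* + 2) (ℤ.pos-* h h))))))
  +τ : + (((m ℕ.∸ 2) ℕ.* (m ℕ.∸ 1)) ℕ./ 2) ≡ B
  +τ = trans (cong +_ (τ-value h)) (trans (ℤ.pos-* (suc (h ℕ.* 2)) (suc h))
    (cong (λ a → (+ 1 + a) * (+ 1 + H)) (ℤ.pos-* h 2)))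
  +2m² : + (2 ℕ.* (m ℕ.* m)) ≡ + 2 * (P * P)
  +2m² = trans (ℤ.pos-* 2 (m ℕ.* m)) (cong (+ 2 *_) (trans (ℤ.pos-* m m) (cong₂ _*_ +m +m)))
  polynomial : (+ 4 * (P * A) - B + + 1) - (B - + 1) ≡ q * (+ 2 * (P * P))
  polynomial = trans (cong₂ (λ a b → (+ 4 * a - b + + 1) - (b - + 1)) (sym +μ̃) (sym +τ)) (trans eq (cong (q *_) +2m²))
  cancel : ∀ a b → a - a + b ≡ b
  cancel = solve-∀
  lemma : ∀ h q → let p = + 3 + h * + 2 ; b = (+ 1 + h * + 2) * (+ 1 + h) in
          p * + 5 ≡ (+ 4 * (p * (+ 5 + h * + 6 + h * h * + 2)) - b + + 1) - (b - + 1) - q * (+ 2 * (p * p))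
                    + p * ((+ 2 * q - + 2 * p + + 1) * p)
  lemma = solve-∀

odd-divisor-of-5 : ∀ h → 3 ℕ.+ h ℕ.* 2 ∣ 5 → 3 ℕ.+ h ℕ.* 2 ≡ 5
odd-divisor-of-5 0 (divides 0 ())
odd-divisor-of-5 0 (divides 1 ())
odd-divisor-of-5 0 (divides (suc (suc _)) ())
odd-divisor-of-5 1             _   = refl
odd-divisor-of-5 (suc (suc h)) m∣5 with ∣⇒≤ m∣5
... | s≤s (s≤s (s≤s (s≤s (s≤s ()))))

-- The exception is genuine: for m = 5 one has `μ̃` = 65 and `τ` = 6, and the exponents 255 and 5
-- differ by 250, a multiple of 2m² = 50.
constants-distinct : ∀ {m} → 3 ≤ m → Odd m → (M : Array ℕ m) → let open Construction M in
                     m ≢ 5 → ¬ (r^ (+ 4 * μ̃ - τ + + 1) ≈ r^ (τ - + 1))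
constants-distinct 3≤m odd M m≢5 eq with odd-form 3≤m odd | eq
... | h , refl | rotation (congruent (ℤ.divides q equality)) =
  m≢5 (odd-divisor-of-5 h (congruent-constants⇒m∣5 h q equality))

mainTheorem3 :
  (m : ℕ) → 3 ≤ m → Odd m → (M : Array ℕ m) → IsMagicSquare M →
  let open Construction M
      x₊ = r^ (+ 2 * μ̃ - τ + + 1)
      x₋ = r^ (- (+ 2 * μ̃) + τ - + 1)
      μ₁ = r^ (+ 4 * μ̃ - τ + + 1)
      μ₂ = r^ (τ - + 1)
  in
  (∀ u v → Odd (toℕ u ℕ.+ toℕ v) → ∀ i c → c < m → ByCase c (ρ u v i c) x₊ x₋) ×
  (∀ u v → Odd (toℕ u ℕ.+ toℕ v) → ∀ j c → c < m → ByCase c (σ u v j c) x₊ x₋) ×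
  -- rows u = 1 and u = 2: the block with u + v odd is the one read from offset c
  (∀ i c → c < m → ByCase c (ρ 0F 0F i 0 ∙ ρ 0F 1F i c) μ₁ μ₂) ×
  (∀ i c → c < m → ByCase c (ρ 1F 0F i c ∙ ρ 1F 1F i 0) μ₁ μ₂) ×
  -- row u = 2 with the offset on the diagonal block instead
  (∀ i c → c < m → Odd c → c ≢ 1 → ρ 1F 0F i 0 ∙ ρ 1F 1F i c ≈ μ₁) ×
  -- the same for columns v = 1 and v = 2
  (∀ j c → c < m → ByCase c (σ 0F 0F j 0 ∙ σ 1F 0F j c) μ₁ μ₂) ×
  (∀ j c → c < m → ByCase c (σ 0F 1F j c ∙ σ 1F 1F j 0) μ₁ μ₂) ×
  (∀ j c → c < m → Odd c → c ≢ 1 → σ 0F 1F j 0 ∙ σ 1F 1F j c ≈ μ₁) ×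
  -- both magic constants arise from Q; they are distinct unless m = 5
  IsSemiMagicSquare D Q μ₁ ×
  IsSemiMagicSquare D Q μ₂ ×
  (m ≢ 5 → ¬ (μ₁ ≈ μ₂))
mainTheorem3 m 3≤m odd M isMagic with odd-form 3≤m odd
... | h , m≡ =
    (λ u v u+v-odd i c c<m → byCase (ρ-mixed u v u+v-odd i c c<m))
  , (λ u v u+v-odd j c c<m → byCase (σ-mixed u v u+v-odd j c c<m))
  , ρ₁ , ρ₂ , (λ i c c<m _ → ρ₂′ i c c<m)
  , σ₁ , σ₂ , (λ j c c<m _ → σ₂′ j c c<m)
  , semiMagic-μ₁ , semiMagic-μ₂ , constants-distinct 3≤m odd M
  where open Products h m≡ odd M isMagic
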